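{- Let $G$ be a cycle of length $L>0$, regarded as a metric graph, and let $w\ge 0$ be an integer. For every graph $G_w$ obtained from $G$ by adding $w$ wormholes, $\mathrm{diam}(G_w)\ge L/(w+2)$. Moreover, if $w$ is even, then there is a choice of $w$ wormholes for which $\mathrm{diam}(G_w)=L/(w+2)$.
   Context: A metric graph is a finite edge-weighted graph regarded as a metric space in which all points in the interior of each edge are included and each edge is locally isometric to an interval whose length is the edge weight; $\mathrm{diam}(G)=\max_{x,y\in G} d_G(x,y)$ over all points of $G$, where $d_G(x,y)$ is the minimum length of a path from $x$ to $y$. A wormhole is a pair of points of $G$ (arbitrary points, not necessarily vertices); adding a wormhole means identifying its two points, equivalently adding an edge of length zero between them. $G_w$ is the metric graph obtained after all the identifications. Different wormholes may share points. -}

module Defs where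

open import Algebra.Bundles using (CommutativeRing)
open import Algebra.Core using (Op₁; Op₂)
open import Data.Fin.Base using (Fin; toℕ)
open import Data.Nat.Base using (ℕ; suc; NonZero)
open import Data.Nat.DivMod using (_mod_)
open import Data.Product.Base using (∃; ∃₂; _×_; _,_)
open import Data.Sum.Base using (_⊎_)
open import Data.Vec.Base using (Vec)
open import Data.Vec.Membership.Propositional using (_∈_)
open import Function.Base using (id)
open import Level using (0ℓ)
open import Relation.Binary.Bundles using (TotalOrder)
open import Relation.Binary.Core using (Rel)
open import Relation.Binary.Structures using (IsDecTotalOrder)
import Algebra.Construct.NaturalChoice.Max as Max
import Algebra.Definitions.RawMonoid as RawMonoid
import Relation.Binary.Construct.NonStrictToStrict as NonStrictToStrict

-- The real numbers, axiomatised as a Dedekind-complete ordered field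
-- (classically unique up to isomorphism).  As in classical mathematics,
-- the order is total and decidable.
record CompleteOrderedField : Set₁ where
  infix  4 _≤_
  infixl 7 _÷_
  infix  8 _⁻¹
  field
    commutativeRing : CommutativeRing 0ℓ 0ℓ
  open CommutativeRing commutativeRing public
  field
    _≤_             : Rel Carrier 0ℓ
    isDecTotalOrder : IsDecTotalOrder _≈_ _≤_
    +-monoʳ-≤       : ∀ z {x y} → x ≤ y → z + x ≤ z + y
    *-nonNeg        : ∀ {x y} → 0# ≤ x → 0# ≤ y → 0# ≤ x * y
    0≉1             : 0# ≉ 1#
    -- the value of 0# ⁻¹ is unspecified
    _⁻¹             : Op₁ Carrier
    ⁻¹-inverseʳ     : ∀ x → x ≉ 0# → x * x ⁻¹ ≈ 1#

  UpperBound : (Carrier → Set) → Carrier → Set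
  UpperBound P b = ∀ x → P x → x ≤ b

  field
    supremum : (P : Carrier → Set) → ∃ P → ∃ (UpperBound P) →
               ∃ λ s → UpperBound P s × (∀ b → UpperBound P b → s ≤ b)

  totalOrder : TotalOrder 0ℓ 0ℓ 0ℓ
  totalOrder = record
    { isTotalOrder = IsDecTotalOrder.isTotalOrder isDecTotalOrder }

  open NonStrictToStrict _≈_ _≤_ public using (_<_)
  open Max totalOrder public using (_⊔_)
  open RawMonoid +-rawMonoid public using (sum) renaming (_×_ to _·_)

  ∣_-_∣ : Op₂ Carrier
  ∣ x - y ∣ = (x - y) ⊔ (y - x)

  _÷_ : Carrier → ℕ → Carrier
  x ÷ n = x * (n · 1#) ⁻¹

module MetricGraphs (R : CompleteOrderedField) where
  open CompleteOrderedField R renaming (Carrier to ℝ)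

  -- Loops, parallel edges and isolated vertices are allowed.  The choice of
  -- source and target only fixes the direction in which each edge is
  -- parametrised.
  record MetricGraph : Set where
    field
      #V #E         : ℕ
      source target : Fin #E → Fin #V
      weight        : Fin #E → ℝ
      weight>0      : ∀ e → 0# < weight e

  module _ (G : MetricGraph) where
    open MetricGraph G

    data Point : Set where
      vertex   : Fin #V → Point
      interior : (e : Fin #E) (t : ℝ) → 0# < t → t < weight e → Point

    -- x At e , t : the point x lies on the closed edge e, at distance t along
    -- it from its source.  The vertex of a loop lies on it at both ends.
    data _At_,_ : Point → Fin #E → ℝ → Set where
      atSource   : ∀ e → vertex (source e) At e , 0#
      atTarget   : ∀ e → vertex (target e) At e , weight e
      atInterior : ∀ e t p q → interior e t p q At e , t

    Wormhole : Set
    Wormhole = Point × Point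

  -- The points of G_w are the points of G, with the two ends of each wormhole
  -- identified.  The identification is encoded by paths that may cross a
  -- wormhole, in either direction, at no cost.
  module _ {G : MetricGraph} {w : ℕ} (W : Vec (Wormhole G) w) where
    open MetricGraph G

    data Path : Point G → Point G → Set where
      []    : ∀ {x} → Path x x
      along : ∀ {x y z} (e : Fin #E) (s t : ℝ) →
              _At_,_ G x e s → _At_,_ G y e t → Path y z → Path x z
      cross : ∀ {x y z} → (x , y) ∈ W ⊎ (y , x) ∈ W → Path y z → Path x z

    length : ∀ {x y} → Path x y → ℝ
    length []                  = 0#
    length (along e s t _ _ p) = ∣ s - t ∣ + length p
    length (cross _ p)         = length p

    IsDistance : Point G → Point G → ℝ → Set
    IsDistance x y d = (∃ λ (p : Path x y) → length p ≈ d)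
                     × (∀ (p : Path x y) → d ≤ length p)

    -- D is the maximum of the distances; this includes that all distances
    -- exist and that the maximum is attained.
    IsDiameter : ℝ → Set
    IsDiameter D = (∃₂ λ x y → IsDistance x y D)
                 × (∀ x y → ∃ λ d → IsDistance x y d × d ≤ D)

  -- The cycle with n ≥ 1 vertices, whose i-th edge joins vertex i to vertex
  -- i + 1 mod n and has weight ℓ i.
  cycle : (n : ℕ) .{{_ : NonZero n}} (ℓ : Fin n → ℝ) →
          (∀ i → 0# < ℓ i) → MetricGraph
  cycle n ℓ ℓ>0 = record
    { #V       = n
    ; #E       = n
    ; source   = id
    ; target   = λ i → suc (toℕ i) mod n
    ; weight   = ℓ
    ; weight>0 = ℓ>0
    }

  totalLength : MetricGraph → ℝ
  totalLength G = sum (MetricGraph.weight G)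

-- Let D be the diameter of the glued circle and d its metric.  Growing a ball around
-- a point x at unit speed, every wormhole adds two new frontier points at the moment it
-- is reached, so L ≤ 2 D + 2 Σ (D - d(x, a)), the sum ranging over the wormholes (a , b).
-- If d(x, y) = D, then d(x, a) + d(y, a) ≥ D, and adding the bounds for x and y gives
-- 2 L ≤ (2 w + 4) D.  For even w, joining every second of w + 2 equally spaced points
-- (P j to P (j + 2)) leaves only two of them, A and B, and d(x, A) + d(x, B) ≤ L/(w + 2)
-- for all x, hence d(x, y) ≤ L/(w + 2) for all x and y.

module Submission where

open import Defs
import Algebra.Construct.NaturalChoice.Max as Max
import Algebra.Construct.NaturalChoice.Min as Min
import Algebra.Properties.CommutativeSemigroup as CommutativeSemigroupProperties
import Algebra.Properties.Group as GroupProperties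
import Algebra.Properties.Ring as RingProperties
import Algebra.Solver.CommutativeMonoid.Normal as CommutativeMonoidSolver
open import Data.Empty using (⊥; ⊥-elim)
open import Data.Fin.Base as Fin using (Fin; toℕ)
open import Data.Fin.Properties using (toℕ-fromℕ<; toℕ-injective; toℕ<n)
open import Data.List.Base as List using (List; []; _∷_; _++_)
open import Data.List.Membership.Propositional using () renaming (_∈_ to _∈ₗ_)
open import Data.List.Relation.Binary.Permutation.Propositional as Perm using (_↭_; ↭-refl; ↭-sym; ↭-trans; prep; swap)
open import Data.List.Relation.Binary.Permutation.Propositional.Properties using (All-resp-↭; ↭-length)
open import Data.List.Relation.Unary.All as All using (All; []; _∷_)
import Data.List.Relation.Unary.All.Properties as All
open import Data.List.Relation.Unary.Any as Any using (Any; here; there)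
import Data.List.Relation.Unary.Any.Properties as Any
open import Data.Nat.Base as ℕ using (ℕ; zero; suc; NonZero; z≤n; s≤s) renaming (_+_ to _+ℕ_)
open import Data.Nat.Divisibility using (_∣_; divides)
open import Data.Nat.DivMod using (_mod_; _%_; n%n≡0; m<n⇒m%n≡m; m%n<n)
import Data.Nat.Properties as ℕ
open import Data.Product.Base using (∃; ∃₂; _×_; _,_; proj₁; proj₂)
open import Data.Sum.Base as Sum using (_⊎_; inj₁; inj₂)
open import Data.Vec.Base as Vec using (Vec; []; _∷_; lookup; tabulate; toList)
open import Data.Vec.Membership.Propositional using (_∈_)
open import Data.Vec.Membership.Propositional.Properties using (∈-tabulate⁺; ∈-toList⁺; ∈-toList⁻)
open import Data.Vec.Properties using (length-toList)
open import Function.Base using (_∘_)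
open import Relation.Binary.Definitions using (tri<; tri≈; tri>)
open import Relation.Binary.PropositionalEquality as ≡ using (_≡_)
open import Relation.Binary.Structures using (IsDecTotalOrder)
open import Relation.Nullary using (¬_; Dec; yes; no)
open import Relation.Nullary.Decidable using (True; toWitness)

-- The growing ball is made static: a wormhole (a , b) reached first at a counts as a ball of radius
-- D - d(x, a) around b, and these w balls together with the ball of radius D around x cover the
-- circle, so that their lengths add up to at least L. One ball per wormhole suffices because the
-- wormholes are crossed in the order in which they are reached: then both ends of a crossed
-- wormhole already have their final arrival times, which is the greedy principle of Dijkstra's
-- algorithm. A single centre x would only give L ≤ (2 w + 2) D, since all the d(x, a) may vanish;
-- two centres at distance D cannot both be close to a wormhole. The other burden is `IsDiameter`,
-- which asks that every distance be realised by a path and that the maximum be attained. Distances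
-- are therefore built as a pseudometric, glued one pair at a time, and compared with paths from
-- both sides afterwards; the maximum exists because the distance functions are 1-Lipschitz on the
-- interval [0, L].

module OrderedField (R : CompleteOrderedField) where
  open CompleteOrderedField R public hiding (zero) renaming (Carrier to ℝ)
  open IsDecTotalOrder isDecTotalOrder public
    using (_≤?_; ≤-respˡ-≈; ≤-respʳ-≈)
    renaming ( refl to ≤-refl; trans to ≤-trans; total to ≤-total; antisym to ≤-antisym
             ; reflexive to ≤-reflexive )
  open Min totalOrder public using (_⊓_; x⊓y≤x; x⊓y≤y; ⊓-glb; ⊓-sel)
  open Max totalOrder public using (x≤x⊔y; x≤y⊔x; ⊔-lub; ⊔-sel)

  module CM = CommutativeMonoidSolver +-commutativeMonoid

  +-mono-≤ : ∀ {a b c d} → a ≤ b → c ≤ d → a + c ≤ b + d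
  +-mono-≤ {a} {b} {c} {d} p q = ≤-trans (+-monoʳ-≤ a q)
    (≤-respˡ-≈ (+-comm d a) (≤-respʳ-≈ (+-comm d b) (+-monoʳ-≤ d p)))

  +-cancelʳ-≤ : ∀ c {a b} → a + c ≤ b + c → a ≤ b
  +-cancelʳ-≤ c {a} {b} p = ≤-respˡ-≈ (cancel a) (≤-respʳ-≈ (cancel b) (+-mono-≤ p ≤-refl))
    where
    cancel : ∀ x → (x + c) + (- c) ≈ x
    cancel x = trans (+-assoc x c (- c)) (trans (+-congˡ (-‿inverseʳ c)) (+-identityʳ x))

  -- Linear equations and inequalities by reflection.

  infixl 6 _:+_ _:-_
  data Lin (n : ℕ) : Set where
    var  : Fin n → Lin n
    :0   : Lin n
    _:+_ : Lin n → Lin n → Lin n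
    :-_  : Lin n → Lin n

  _:-_ : ∀ {n} → Lin n → Lin n → Lin n
  a :- b = a :+ (:- b)

  ⟦_⟧ : ∀ {n} → Lin n → Vec ℝ n → ℝ
  ⟦ var i ⟧  ρ = lookup ρ i
  ⟦ :0 ⟧     ρ = 0#
  ⟦ a :+ b ⟧ ρ = ⟦ a ⟧ ρ + ⟦ b ⟧ ρ
  ⟦ :- a ⟧   ρ = - ⟦ a ⟧ ρ

  -- a is rewritten as positives a - negatives a, so that equations between linear
  -- expressions are decided by the normal forms of commutative monoids.
  positives negatives : ∀ {n} → Lin n → CM.Expr n
  positives (var i)  = CM.var i
  positives :0       = CM.id
  positives (a :+ b) = positives a CM.⊕ positives b
  positives (:- a)   = negatives a
  negatives (var i)  = CM.id
  negatives :0       = CM.id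
  negatives (a :+ b) = negatives a CM.⊕ negatives b
  negatives (:- a)   = positives a

  private
    open CommutativeSemigroupProperties +-commutativeSemigroup using (interchange)

    ⟦_⟧⁺ : ∀ {n} → CM.Expr n → Vec ℝ n → ℝ
    ⟦_⟧⁺ = CM.⟦_⟧

    split : ∀ {n} (e : Lin n) ρ → ⟦ e ⟧ ρ + ⟦ negatives e ⟧⁺ ρ ≈ ⟦ positives e ⟧⁺ ρ
    split (var i)  ρ = +-identityʳ _
    split :0       ρ = +-identityʳ _
    split (a :+ b) ρ = trans (interchange _ _ _ _) (+-cong (split a ρ) (split b ρ))
    split (:- a)   ρ = trans (+-congˡ (sym (split a ρ)))
      (trans (sym (+-assoc _ _ _)) (trans (+-congʳ (-‿inverseˡ _)) (+-identityˡ _)))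

  Balanced : ∀ {n} (a b : Lin n) → Set
  Balanced a b = True (CM.normalise (positives a CM.⊕ negatives b) CM.≟ CM.normalise (positives b CM.⊕ negatives a))

  -- Once the negatives of both sides are added to both sides, only sums without minus signs remain,
  -- and these are compared by their commutative normal forms.
  balanced⇒≈ : ∀ {n} (a b : Lin n) → Balanced a b → ∀ ρ → ⟦ a ⟧ ρ ≈ ⟦ b ⟧ ρ
  balanced⇒≈ a b eq ρ = GroupProperties.∙-cancelʳ +-group (⟦ negatives a ⟧⁺ ρ + ⟦ negatives b ⟧⁺ ρ) _ _
    (trans (cross a b) (trans same (trans (sym (cross b a)) (+-congˡ (+-comm _ _)))))
    where
    cross : ∀ a b → ⟦ a ⟧ ρ + (⟦ negatives a ⟧⁺ ρ + ⟦ negatives b ⟧⁺ ρ) ≈ ⟦ positives a ⟧⁺ ρ + ⟦ negatives b ⟧⁺ ρ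
    cross a b = trans (sym (+-assoc _ _ _)) (+-congʳ (split a ρ))
    same : ⟦ positives a ⟧⁺ ρ + ⟦ negatives b ⟧⁺ ρ ≈ ⟦ positives b ⟧⁺ ρ + ⟦ negatives a ⟧⁺ ρ
    same = trans (sym (CM.correct (positives a CM.⊕ negatives b) ρ))
      (trans (reflexive (≡.cong (λ v → CM.⟦ v ⟧⇓ ρ) (toWitness eq)))
             (CM.correct (positives b CM.⊕ negatives a) ρ))

  infix 5.5 _≼_
  record Inequality (n : ℕ) : Set where
    constructor _≼_
    field lower upper : Lin n

  ⟦_⟧≤ : ∀ {n} → Inequality n → Vec ℝ n → Set
  ⟦ a ≼ b ⟧≤ ρ = ⟦ a ⟧ ρ ≤ ⟦ b ⟧ ρ

  infix 3 _⊢_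
  record Sequent (n : ℕ) : Set where
    constructor _⊢_
    field
      hypotheses : List (Inequality n)
      conclusion : Inequality n

  Σlower Σupper : ∀ {n} → List (Inequality n) → Lin n
  Σlower []            = :0
  Σlower ((a ≼ _) ∷ Γ) = a :+ Σlower Γ
  Σupper []            = :0
  Σupper ((_ ≼ b) ∷ Γ) = b :+ Σupper Γ

  Entails : ∀ {n} → Sequent n → Vec ℝ n → Set
  Entails ([]    ⊢ g) ρ = ⟦ g ⟧≤ ρ
  Entails (h ∷ Γ ⊢ g) ρ = ⟦ h ⟧≤ ρ → Entails (Γ ⊢ g) ρ

  IsSum : ∀ {n} → Sequent n → Set
  IsSum (Γ ⊢ (a ≼ b)) = Balanced (a :+ Σupper Γ) (b :+ Σlower Γ)

  variables : ∀ {n} → Vec (Lin n) n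
  variables = tabulate var

  -- The hypotheses are simply added up; one that is needed with a coefficient is repeated.
  linear : ∀ {n} (ρ : Vec ℝ n) (S : Vec (Lin n) n → Sequent n) →
           {IsSum (S variables)} → Entails (S variables) ρ
  linear ρ S {ok} = go (Sequent.hypotheses (S variables)) λ le →
    let (Γ ⊢ (a ≼ b)) = S variables in
    +-cancelʳ-≤ (⟦ Σlower Γ ⟧ ρ) (≤-respʳ-≈ (balanced⇒≈ (a :+ Σupper Γ) (b :+ Σlower Γ) ok ρ) (+-monoʳ-≤ (⟦ a ⟧ ρ) le))
    where
    go : ∀ Γ {g} → (⟦ Σlower Γ ⟧ ρ ≤ ⟦ Σupper Γ ⟧ ρ → ⟦ g ⟧≤ ρ) → Entails (Γ ⊢ g) ρ
    go []      k   = k ≤-refl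
    go (_ ∷ Γ) k h = go Γ λ le → k (+-mono-≤ h le)

  infix 5.5 _≍_
  record Equation (n : ℕ) : Set where
    constructor _≍_
    field left right : Lin n

  identity : ∀ {n} (ρ : Vec ℝ n) (E : Vec (Lin n) n → Equation n) →
             let (a ≍ b) = E variables in {Balanced a b} → ⟦ a ⟧ ρ ≈ ⟦ b ⟧ ρ
  identity ρ E {ok} = balanced⇒≈ (Equation.left (E variables)) (Equation.right (E variables)) ok ρ

  -- Order, natural multiples, division and absolute values.

  ≰⇒≥ : ∀ {a b} → ¬ a ≤ b → b ≤ a
  ≰⇒≥ {a} {b} a≰b with ≤-total a b
  ... | inj₁ a≤b = ⊥-elim (a≰b a≤b)
  ... | inj₂ b≤a = b≤a

  ≰⇒> : ∀ {a b} → ¬ b ≤ a → a < b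
  ≰⇒> b≰a = ≰⇒≥ b≰a , λ a≈b → b≰a (≤-reflexive (sym a≈b))

  double-cancel-≤ : ∀ {a b} → a + a ≤ b + b → a ≤ b
  double-cancel-≤ {a} {b} 2a≤2b with ≤-total a b
  ... | inj₁ a≤b = a≤b
  ... | inj₂ b≤a = linear (a ∷ b ∷ []) (λ { (a ∷ b ∷ []) → a :+ a ≼ b :+ b ∷ b ≼ a ∷ [] ⊢ a ≼ b }) 2a≤2b b≤a

  -- If 1 ≤ 0, then 0 ≤ -1, and the square of -1 is both 1 and a product of nonnegative numbers.
  0≤1 : 0# ≤ 1#
  0≤1 with ≤-total 0# 1#
  ... | inj₁ 0≤1 = 0≤1
  ... | inj₂ 1≤0 = ≤-respʳ-≈ (trans (sym (-‿distribˡ-* _ _)) (trans (-‿cong (*-identityˡ _)) (-‿involutive 1#)))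
                     (*-nonNeg 0≤-1 0≤-1)
    where
    open RingProperties ring
    0≤-1 : 0# ≤ - 1#
    0≤-1 = linear (1# ∷ []) (λ { (o ∷ []) → o ≼ :0 ∷ [] ⊢ :0 ≼ :- o }) 1≤0

  ·-nonNeg : ∀ n {x} → 0# ≤ x → 0# ≤ n · x
  ·-nonNeg zero    0≤x = ≤-refl
  ·-nonNeg (suc n) 0≤x = ≤-respˡ-≈ (+-identityˡ 0#) (+-mono-≤ 0≤x (·-nonNeg n 0≤x))

  ·-monoʳ-≤ : ∀ n {x y} → x ≤ y → n · x ≤ n · y
  ·-monoʳ-≤ zero    x≤y = ≤-refl
  ·-monoʳ-≤ (suc n) x≤y = +-mono-≤ x≤y (·-monoʳ-≤ n x≤y)

  ·-monoˡ-≤ : ∀ {x m n} → 0# ≤ x → m ℕ.≤ n → m · x ≤ n · x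
  ·-monoˡ-≤ {n = n} 0≤x ℕ.z≤n       = ·-nonNeg n 0≤x
  ·-monoˡ-≤         0≤x (ℕ.s≤s m≤n) = +-monoʳ-≤ _ (·-monoˡ-≤ 0≤x m≤n)

  ·-zeroʳ-≤ : ∀ n → n · 0# ≤ 0#
  ·-zeroʳ-≤ zero    = ≤-refl
  ·-zeroʳ-≤ (suc n) = ≤-respˡ-≈ (sym (+-identityˡ _)) (·-zeroʳ-≤ n)

  ·-cancelˡ-≤ : ∀ n {x y} → suc n · x ≤ suc n · y → x ≤ y
  ·-cancelˡ-≤ n {x} {y} p with ≤-total x y
  ... | inj₁ x≤y = x≤y
  ... | inj₂ y≤x = linear (x ∷ y ∷ n · x ∷ n · y ∷ [])
    (λ { (x ∷ y ∷ nx ∷ ny ∷ []) → x :+ nx ≼ y :+ ny ∷ ny ≼ nx ∷ [] ⊢ x ≼ y }) p (·-monoʳ-≤ n y≤x)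

  ·-as-* : ∀ n x → n · x ≈ (n · 1#) * x
  ·-as-* zero    x = sym (zeroˡ x)
  ·-as-* (suc n) x = sym (trans (distribʳ x 1# (n · 1#)) (+-cong (*-identityˡ x) (sym (·-as-* n x))))

  ·-÷ : ∀ n x → suc n · (x ÷ suc n) ≈ x
  ·-÷ n x = trans (·-as-* (suc n) _) (trans (sym (*-assoc k x (k ⁻¹)))
    (trans (*-congʳ (*-comm k x)) (trans (*-assoc x k (k ⁻¹))
      (trans (*-congˡ (⁻¹-inverseʳ k k≉0)) (*-identityʳ x)))))
    where
    k = suc n · 1#
    -- The inverse is specified only away from zero. If 1 + n · 1 were zero, then n · 1 ≥ 0 would
    -- force 1 ≤ 0.
    k≉0 : k ≉ 0#
    k≉0 k≈0 = 0≉1 (≤-antisym 0≤1 (linear (1# ∷ n · 1# ∷ [])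
      (λ { (o ∷ m ∷ []) → o :+ m ≼ :0 ∷ :0 ≼ m ∷ [] ⊢ o ≼ :0 }) (≤-reflexive k≈0) (·-nonNeg n 0≤1)))

  half : ℝ → ℝ
  half x = x ÷ 2

  half+half : ∀ x → half x + half x ≈ x
  half+half x = trans (+-congˡ (sym (+-identityʳ _))) (·-÷ 1 x)

  x-y≤∣x-y∣ : ∀ x y → x - y ≤ ∣ x - y ∣
  x-y≤∣x-y∣ x y = x≤x⊔y _ _

  y-x≤∣x-y∣ : ∀ x y → y - x ≤ ∣ x - y ∣
  y-x≤∣x-y∣ x y = x≤y⊔x _ _

  ∣x-y∣≤ : ∀ {x y z} → x - y ≤ z → y - x ≤ z → ∣ x - y ∣ ≤ z
  ∣x-y∣≤ = ⊔-lub

  ∣-∣-cases : ∀ {p} (P : ℝ → Set p) → (∀ {a b} → a ≈ b → P a → P b) → ∀ x y →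
              P (x - y) → P (y - x) → P ∣ x - y ∣
  ∣-∣-cases P resp x y p q with ⊔-sel (x - y) (y - x)
  ... | inj₁ eq = resp (sym eq) p
  ... | inj₂ eq = resp (sym eq) q

  ⊓-positives : ∀ {x y} → ¬ x ≤ 0# → ¬ y ≤ 0# → ¬ x ⊓ y ≤ 0#
  ⊓-positives {x} {y} x>0 y>0 x⊓y≤0 with ⊓-sel x y
  ... | inj₁ eq = x>0 (≤-respˡ-≈ eq x⊓y≤0)
  ... | inj₂ eq = y>0 (≤-respˡ-≈ eq x⊓y≤0)

  Within : ℝ → ℝ → Set
  Within L t = 0# ≤ t × t ≤ L

  -- A 1-Lipschitz function on [0, L] attains its maximum.

  module Maximum {L : ℝ} (0≤L : 0# ≤ L) (f : ℝ → ℝ)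
    (lipschitz : ∀ {s t} → Within L s → Within L t → f s ≤ f t + ∣ s - t ∣) where

    0∈ : Within L 0#
    0∈ = ≤-refl , 0≤L

    close : ∀ {t c δ} → Within L t → Within L c → t - c ≤ δ → c - t ≤ δ → f t ≤ f c + δ
    close t∈ c∈ p q = ≤-trans (lipschitz t∈ c∈) (+-monoʳ-≤ _ (∣x-y∣≤ p q))

    Value : ℝ → Set
    Value v = ∃ λ t → Within L t × f t ≈ v

    bounded : ∀ v → Value v → v ≤ f 0# + L
    bounded v (t , t∈@(0≤t , t≤L) , ft≈v) = ≤-respˡ-≈ ft≈v (close t∈ 0∈
      (linear (t ∷ L ∷ []) (λ { (t ∷ L ∷ []) → t ≼ L ∷ [] ⊢ t :- :0 ≼ L }) t≤L)
      (linear (t ∷ L ∷ []) (λ { (t ∷ L ∷ []) → :0 ≼ t ∷ :0 ≼ L ∷ [] ⊢ :0 :- t ≼ L }) 0≤t 0≤L))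

    module _ (M : ℝ) (f≤M : ∀ {t} → Within L t → f t ≤ M)
             (M-least : ∀ b → (∀ {t} → Within L t → f t ≤ b) → M ≤ b) where

      -- f attains its supremum M at the supremum of the x such that f stays below M
      -- by a positive margin on [0 , x].
      Below : ℝ → Set
      Below x = Within L x × ∃ λ ε → ¬ ε ≤ 0# × (∀ {t} → Within L t → t ≤ x → f t + ε ≤ M)

      -- Only points `_≈_` to 0 are concerned, but `f` is not assumed to respect `_≈_`; the
      -- Lipschitz bound with δ = 0 replaces congruence.
      0∈Below : ¬ M ≤ f 0# → Below 0#
      0∈Below M≰f0 = 0∈ , M - f 0# ,
        (λ p → M≰f0 (linear (M ∷ f 0# ∷ []) (λ { (M ∷ a ∷ []) → M :- a ≼ :0 ∷ [] ⊢ M ≼ a }) p)) ,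
        λ {t} t∈ t≤0 → linear (f t ∷ f 0# ∷ M ∷ [])
          (λ { (b ∷ a ∷ M ∷ []) → b ≼ a :+ :0 ∷ [] ⊢ b :+ (M :- a) ≼ M })
          (close t∈ 0∈
            (linear (t ∷ []) (λ { (t ∷ []) → t ≼ :0 ∷ [] ⊢ t :- :0 ≼ :0 }) t≤0)
            (linear (t ∷ []) (λ { (t ∷ []) → :0 ≼ t ∷ [] ⊢ :0 :- t ≼ :0 }) (proj₁ t∈)))

      module _ {c : ℝ} (c∈ : Within L c) (Below⇒≤c : ∀ {x} → Below x → x ≤ c) where

        module _ {δ : ℝ} (δ>0 : ¬ δ ≤ 0#) (2δ≤ : δ + δ ≤ M - f c) where

          near : ∀ {t} → Within L t → c - δ ≤ t → t ≤ c + δ → f t + δ ≤ M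
          near {t} t∈ p q = linear (f t ∷ f c ∷ δ ∷ M ∷ [])
            (λ { (b ∷ a ∷ δ ∷ M ∷ []) → b ≼ a :+ δ ∷ δ :+ δ ≼ M :- a ∷ [] ⊢ b :+ δ ≼ M })
            (close t∈ c∈
              (linear (t ∷ c ∷ δ ∷ []) (λ { (t ∷ c ∷ δ ∷ []) → t ≼ c :+ δ ∷ [] ⊢ t :- c ≼ δ }) q)
              (linear (t ∷ c ∷ δ ∷ []) (λ { (t ∷ c ∷ δ ∷ []) → c :- δ ≼ t ∷ [] ⊢ c :- t ≼ δ }) p))
            2δ≤

          -- If some x in `Below` exceeded c - δ, its margin on [0, x] and the margin δ around c
          -- would combine to a margin on [0, c′], where c′ is the smaller of c + δ and L. Then c′ ≤
          -- c. If c′ is c + δ, this contradicts δ > 0; if c′ is L, the margin holds everywhere and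
          -- M is not the least upper bound.
          Below⇒≤c-δ : ∀ x → Below x → x ≤ c - δ
          Below⇒≤c-δ x (x∈ , ε , ε>0 , below) with x ≤? (c - δ)
          ... | yes x≤c-δ = x≤c-δ
          ... | no  x≰c-δ = ⊥-elim (absurd (⊓-sel (c + δ) L))
            where
            below′ : ∀ {t} → Within L t → t ≤ (c + δ) ⊓ L → f t + (ε ⊓ δ) ≤ M
            below′ {t} t∈ t≤c′ with t ≤? x
            ... | yes t≤x = ≤-trans (+-monoʳ-≤ _ (x⊓y≤x ε δ)) (below t∈ t≤x)
            ... | no  t≰x = ≤-trans (+-monoʳ-≤ _ (x⊓y≤y ε δ))
              (near t∈ (≤-trans (≰⇒≥ x≰c-δ) (≰⇒≥ t≰x)) (≤-trans t≤c′ (x⊓y≤x _ _)))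

            0≤c+δ : 0# ≤ c + δ
            0≤c+δ = linear (c ∷ δ ∷ []) (λ { (c ∷ δ ∷ []) → :0 ≼ c ∷ :0 ≼ δ ∷ [] ⊢ :0 ≼ c :+ δ })
              (proj₁ c∈) (≰⇒≥ δ>0)

            c′≤c : (c + δ) ⊓ L ≤ c
            c′≤c = Below⇒≤c ((⊓-glb 0≤c+δ 0≤L , x⊓y≤y (c + δ) L) , ε ⊓ δ , ⊓-positives ε>0 δ>0 , below′)

            absurd : (c + δ) ⊓ L ≈ c + δ ⊎ (c + δ) ⊓ L ≈ L → ⊥
            absurd (inj₁ eq) = δ>0 (linear (c ∷ δ ∷ [])
              (λ { (c ∷ δ ∷ []) → c :+ δ ≼ c ∷ [] ⊢ δ ≼ :0 }) (≤-respˡ-≈ eq c′≤c))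
            absurd (inj₂ eq) = ⊓-positives ε>0 δ>0 (linear (ε ⊓ δ ∷ M ∷ [])
              (λ { (ε ∷ M ∷ []) → M ≼ M :- ε ∷ [] ⊢ ε ≼ :0 })
              (M-least (M - (ε ⊓ δ)) λ {t} t∈ →
                linear (f t ∷ ε ⊓ δ ∷ M ∷ []) (λ { (b ∷ ε ∷ M ∷ []) → b :+ ε ≼ M ∷ [] ⊢ b ≼ M :- ε })
                  (below′ t∈ (≤-respʳ-≈ (sym eq) (proj₂ t∈)))))

        M≤fc : (∀ b → UpperBound Below b → c ≤ b) → M ≤ f c
        M≤fc c-least with M ≤? f c
        ... | yes M≤fc = M≤fc
        ... | no  M≰fc = ⊥-elim (δ>0 (linear (c ∷ δ ∷ []) (λ { (c ∷ δ ∷ []) → c ≼ c :- δ ∷ [] ⊢ δ ≼ :0 })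
          (c-least (c - δ) (Below⇒≤c-δ δ>0 (≤-reflexive (half+half _))))))
          where
          -- Within δ of c the function rises by at most δ, which uses up one half of the gap and
          -- leaves the other half as margin.
          δ = half (M - f c)

          δ>0 : ¬ δ ≤ 0#
          δ>0 δ≤0 = M≰fc (linear (δ ∷ M ∷ f c ∷ [])
            (λ { (δ ∷ M ∷ a ∷ []) → δ ≼ :0 ∷ δ ≼ :0 ∷ M :- a ≼ δ :+ δ ∷ [] ⊢ M ≼ a })
            δ≤0 δ≤0 (≤-reflexive (sym (half+half _))))

      attained : ∃ λ c → Within L c × M ≤ f c
      attained with M ≤? f 0#
      ... | yes M≤f0 = 0# , 0∈ , M≤f0
      ... | no  M≰f0 =
        let (c , Below⇒≤c , c-least) = supremum Below (0# , 0∈Below M≰f0) (L , λ _ x∈ → proj₂ (proj₁ x∈))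
            c∈ = Below⇒≤c 0# (0∈Below M≰f0) , c-least L (λ _ x∈ → proj₂ (proj₁ x∈))
        in c , c∈ , M≤fc c∈ (Below⇒≤c _) c-least

    abstract
      maximum : ∃ λ c → Within L c × (∀ {t} → Within L t → f t ≤ f c)
      maximum =
        let (M , Value⇒≤M , M-least) = supremum Value (f 0# , 0# , 0∈ , refl) (f 0# + L , bounded)
            f≤M = λ {t} t∈ → Value⇒≤M (f t) (t , t∈ , refl)
            (c , c∈ , M≤fc) = attained M f≤M
              λ b f≤b → M-least b λ { v (t , t∈ , ft≈v) → ≤-respˡ-≈ ft≈v (f≤b t∈) }
        in c , c∈ , λ t∈ → ≤-trans (f≤M t∈) M≤fc

  open Maximum public using (maximum)

-- Pseudometrics and the identification of pairs of points.

module Gluing (R : CompleteOrderedField) where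
  open OrderedField R

  ∑ : ∀ {A : Set} → (A → ℝ) → List A → ℝ
  ∑ f []       = 0#
  ∑ f (x ∷ xs) = f x + ∑ f xs

  ∑-↭ : ∀ {A : Set} (f : A → ℝ) {xs ys} → xs ↭ ys → ∑ f xs ≈ ∑ f ys
  ∑-↭ f Perm.refl        = refl
  ∑-↭ f (prep x p)       = +-congˡ (∑-↭ f p)
  ∑-↭ f (swap {xs} {ys} x y p) = trans (+-congˡ (+-congˡ (∑-↭ f p)))
    (identity (f x ∷ f y ∷ ∑ f ys ∷ []) λ { (x ∷ y ∷ s ∷ []) → x :+ (y :+ s) ≍ y :+ (x :+ s) })
  ∑-↭ f (Perm.trans p q) = trans (∑-↭ f p) (∑-↭ f q)

  ∑-++ : ∀ {A : Set} (f : A → ℝ) xs ys → ∑ f (xs ++ ys) ≈ ∑ f xs + ∑ f ys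
  ∑-++ f []       ys = sym (+-identityˡ _)
  ∑-++ f (x ∷ xs) ys = trans (+-congˡ (∑-++ f xs ys)) (sym (+-assoc _ _ _))

  extract-min : ∀ {A : Set} (v : A → ℝ) x xs →
                ∃₂ λ m rest → (x ∷ xs) ↭ (m ∷ rest) × All (λ y → v m ≤ v y) rest
  extract-min v x []       = x , [] , ↭-refl , []
  extract-min v x (y ∷ xs) with extract-min v y xs
  ... | m , rest , perm , minimal with v x ≤? v m
  ...   | yes x≤m = x , y ∷ xs , ↭-refl ,
                    All-resp-↭ (↭-sym perm) (x≤m ∷ All.map (≤-trans x≤m) minimal)
  ...   | no  x≰m = m , x ∷ rest , ↭-trans (prep x perm) (swap x m ↭-refl) , ≰⇒≥ x≰m ∷ minimal

  -- Identified points stay distinct elements at distance zero, so gluing only changes `dist` and no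
  -- quotient has to be formed.
  record PseudoMetric (X : Set) : Set where
    field
      dist      : X → X → ℝ
      dist-refl : ∀ x → dist x x ≤ 0#
      dist-sym  : ∀ x y → dist x y ≤ dist y x
      triangle  : ∀ x y z → dist x z ≤ dist x y + dist y z

    dist-nonNeg : ∀ x y → 0# ≤ dist x y
    dist-nonNeg x y = double-cancel-≤ (linear (dist x y ∷ dist y x ∷ dist x x ∷ [])
      (λ { (xy ∷ yx ∷ xx ∷ []) → xx ≼ xx :+ xx ∷ xx ≼ xy :+ yx ∷ yx ≼ xy ∷ [] ⊢ :0 :+ :0 ≼ xy :+ xy })
      (triangle x x x) (triangle x y x) (dist-sym y x))

  module _ {X : Set} where
    open PseudoMetric

    module Glue (d : PseudoMetric X) (a b : X) where

      -- A shortest path uses the new pair at most once, in one of two directions. Carrying an upper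
      -- bound `r` instead of the exact length allows routes to be reversed and concatenated kind by
      -- kind.
      data Route (x y : X) (r : ℝ) : Set where
        direct   : dist d x y ≤ r → Route x y r
        forward  : dist d x a + dist d b y ≤ r → Route x y r
        backward : dist d x b + dist d a y ≤ r → Route x y r

      shortest : X → X → ℝ
      shortest x y = dist d x y ⊓ ((dist d x a + dist d b y) ⊓ (dist d x b + dist d a y))

      route : ∀ x y → Route x y (shortest x y)
      route x y with ⊓-sel (dist d x y) ((dist d x a + dist d b y) ⊓ (dist d x b + dist d a y))
      ... | inj₁ eq = direct (≤-reflexive (sym eq))
      ... | inj₂ eq with ⊓-sel (dist d x a + dist d b y) (dist d x b + dist d a y)
      ...   | inj₁ eq′ = forward (≤-reflexive (sym (trans eq eq′)))
      ...   | inj₂ eq′ = backward (≤-reflexive (sym (trans eq eq′)))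

      shortest≤ : ∀ {x y r} → Route x y r → shortest x y ≤ r
      shortest≤ (direct   p) = ≤-trans (x⊓y≤x _ _) p
      shortest≤ (forward  p) = ≤-trans (≤-trans (x⊓y≤y _ _) (x⊓y≤x _ _)) p
      shortest≤ (backward p) = ≤-trans (≤-trans (x⊓y≤y _ _) (x⊓y≤y _ _)) p

      reverse : ∀ {x y r} → Route x y r → Route y x r
      reverse {x} {y} (direct   p) = direct (≤-trans (dist-sym d y x) p)
      reverse {x} {y} (forward  p) = backward (≤-trans (≤-trans (+-mono-≤ (dist-sym d y b) (dist-sym d a x)) (≤-reflexive (+-comm _ _))) p)
      reverse {x} {y} (backward p) = forward (≤-trans (≤-trans (+-mono-≤ (dist-sym d y a) (dist-sym d b x)) (≤-reflexive (+-comm _ _))) p)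

      -- The triangle inequality of the glued metric. Two crossings in the same direction shorten to
      -- one, and two opposite crossings cancel, because the stretch between them has nonnegative
      -- length.
      compose : ∀ {x y z r s} → Route x y r → Route y z s → Route x z (r + s)
      compose {x} {y} {z} (direct p) (direct q) = direct (≤-trans (triangle d x y z) (+-mono-≤ p q))
      compose {x} {y} {z} {r} {s} (direct p) (forward q) = forward (linear
        (dist d x a ∷ dist d x y ∷ dist d y a ∷ dist d b z ∷ r ∷ s ∷ [])
        (λ { (xa ∷ xy ∷ ya ∷ bz ∷ r ∷ s ∷ []) → xa ≼ xy :+ ya ∷ xy ≼ r ∷ ya :+ bz ≼ s ∷ [] ⊢ xa :+ bz ≼ r :+ s })
        (triangle d x y a) p q)
      compose {x} {y} {z} {r} {s} (direct p) (backward q) = backward (linear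
        (dist d x b ∷ dist d x y ∷ dist d y b ∷ dist d a z ∷ r ∷ s ∷ [])
        (λ { (xa ∷ xy ∷ ya ∷ bz ∷ r ∷ s ∷ []) → xa ≼ xy :+ ya ∷ xy ≼ r ∷ ya :+ bz ≼ s ∷ [] ⊢ xa :+ bz ≼ r :+ s })
        (triangle d x y b) p q)
      compose {x} {y} {z} {r} {s} (forward p) (direct q) = forward (linear
        (dist d x a ∷ dist d b y ∷ dist d y z ∷ dist d b z ∷ r ∷ s ∷ [])
        (λ { (xa ∷ by ∷ yz ∷ bz ∷ r ∷ s ∷ []) → bz ≼ by :+ yz ∷ xa :+ by ≼ r ∷ yz ≼ s ∷ [] ⊢ xa :+ bz ≼ r :+ s })
        (triangle d b y z) p q)
      compose {x} {y} {z} {r} {s} (backward p) (direct q) = backward (linear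
        (dist d x b ∷ dist d a y ∷ dist d y z ∷ dist d a z ∷ r ∷ s ∷ [])
        (λ { (xa ∷ by ∷ yz ∷ bz ∷ r ∷ s ∷ []) → bz ≼ by :+ yz ∷ xa :+ by ≼ r ∷ yz ≼ s ∷ [] ⊢ xa :+ bz ≼ r :+ s })
        (triangle d a y z) p q)
      compose {x} {y} {z} {r} {s} (forward p) (forward q) = forward (linear
        (dist d x a ∷ dist d b y ∷ dist d y a ∷ dist d b z ∷ r ∷ s ∷ [])
        (λ { (xa ∷ by ∷ ya ∷ bz ∷ r ∷ s ∷ []) → :0 ≼ by ∷ :0 ≼ ya ∷ xa :+ by ≼ r ∷ ya :+ bz ≼ s ∷ [] ⊢ xa :+ bz ≼ r :+ s })
        (dist-nonNeg d b y) (dist-nonNeg d y a) p q)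
      compose {x} {y} {z} {r} {s} (backward p) (backward q) = backward (linear
        (dist d x b ∷ dist d a y ∷ dist d y b ∷ dist d a z ∷ r ∷ s ∷ [])
        (λ { (xa ∷ by ∷ ya ∷ bz ∷ r ∷ s ∷ []) → :0 ≼ by ∷ :0 ≼ ya ∷ xa :+ by ≼ r ∷ ya :+ bz ≼ s ∷ [] ⊢ xa :+ bz ≼ r :+ s })
        (dist-nonNeg d a y) (dist-nonNeg d y b) p q)
      compose {x} {y} {z} {r} {s} (forward p) (backward q) = direct (linear
        (dist d x a ∷ dist d b y ∷ dist d y b ∷ dist d a z ∷ dist d x z ∷ r ∷ s ∷ [])
        (λ { (xa ∷ by ∷ yb ∷ az ∷ xz ∷ r ∷ s ∷ []) → xz ≼ xa :+ az ∷ :0 ≼ by ∷ :0 ≼ yb ∷ xa :+ by ≼ r ∷ yb :+ az ≼ s ∷ [] ⊢ xz ≼ r :+ s })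
        (triangle d x a z) (dist-nonNeg d b y) (dist-nonNeg d y b) p q)
      compose {x} {y} {z} {r} {s} (backward p) (forward q) = direct (linear
        (dist d x b ∷ dist d a y ∷ dist d y a ∷ dist d b z ∷ dist d x z ∷ r ∷ s ∷ [])
        (λ { (xa ∷ by ∷ yb ∷ az ∷ xz ∷ r ∷ s ∷ []) → xz ≼ xa :+ az ∷ :0 ≼ by ∷ :0 ≼ yb ∷ xa :+ by ≼ r ∷ yb :+ az ≼ s ∷ [] ⊢ xz ≼ r :+ s })
        (triangle d x b z) (dist-nonNeg d a y) (dist-nonNeg d y a) p q)

      glue : PseudoMetric X
      glue .dist = shortest
      glue .dist-refl x = shortest≤ (direct (dist-refl d x))
      glue .dist-sym x y = shortest≤ (reverse (route y x))
      glue .triangle x y z = shortest≤ (compose (route x y) (route y z))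

      glued : shortest a b ≤ 0#
      glued = shortest≤ (forward (linear (dist d a a ∷ dist d b b ∷ [])
        (λ { (aa ∷ bb ∷ []) → aa ≼ :0 ∷ bb ≼ :0 ∷ [] ⊢ aa :+ bb ≼ :0 }) (dist-refl d a) (dist-refl d b)))

    open Glue using (glue)

    glueAll : PseudoMetric X → List (X × X) → PseudoMetric X
    glueAll d = List.foldr (λ { (a , b) d′ → glue d′ a b }) d

    glueAll≤ : ∀ d W x y → dist (glueAll d W) x y ≤ dist d x y
    glueAll≤ d []            x y = ≤-refl
    glueAll≤ d ((a , b) ∷ W) x y = ≤-trans (x⊓y≤x _ _) (glueAll≤ d W x y)

    glueAll-∈ : ∀ d {W a b} → (a , b) ∈ₗ W → dist (glueAll d W) a b ≤ 0#
    glueAll-∈ d {(a , b) ∷ W} (here ≡.refl) = Glue.glued (glueAll d W) a b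
    glueAll-∈ d {_ ∷ W}       (there p)     = ≤-trans (x⊓y≤x _ _) (glueAll-∈ d p)

    Lipschitz : PseudoMetric X → (X → ℝ) → Set
    Lipschitz d f = ∀ x y → f y ≤ f x + dist d x y

    Consistent : (X → ℝ) → List (X × X) → Set
    Consistent f = All λ { (a , b) → f a ≤ f b × f b ≤ f a }

    dist-Lipschitz : ∀ d x → Lipschitz d (dist d x)
    dist-Lipschitz d x y z = triangle d x y z

    glueAll-consistent : ∀ d W x → Consistent (dist (glueAll d W) x) W
    glueAll-consistent d W x = All.tabulate λ { {a , b} ab∈W →
      along-zero x b a (≤-trans (dist-sym D b a) (glueAll-∈ d ab∈W)) , along-zero x a b (glueAll-∈ d ab∈W) }
      where
      D = glueAll d W
      along-zero : ∀ x y z → dist D y z ≤ 0# → dist D x z ≤ dist D x y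
      along-zero x y z yz≤0 = ≤-trans (triangle D x y z)
        (≤-respʳ-≈ (+-identityʳ _) (+-monoʳ-≤ _ yz≤0))

    -- glueAll d W is the largest pseudometric below d that identifies the pairs in W.
    Lipschitz-glueAll : ∀ d {f} W → Lipschitz d f → Consistent f W → Lipschitz (glueAll d W) f
    Lipschitz-glueAll d     []            lip []                    = lip
    Lipschitz-glueAll d {f} ((a , b) ∷ W) lip ((fa≤fb , fb≤fa) ∷ con) x y = bound (Glue.route D a b x y)
      where
      D   = glueAll d W
      ih  = Lipschitz-glueAll d W lip con
      bound : ∀ {r} → Glue.Route D a b x y r → f y ≤ f x + r
      bound (Glue.direct p) = ≤-trans (ih x y) (+-monoʳ-≤ _ p)
      bound {r} (Glue.forward p) = linear (f x ∷ f y ∷ f a ∷ f b ∷ dist D x a ∷ dist D b y ∷ r ∷ [])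
        (λ { (x ∷ y ∷ a ∷ b ∷ xa ∷ by ∷ r ∷ []) → a ≼ x :+ xa ∷ b ≼ a ∷ y ≼ b :+ by ∷ xa :+ by ≼ r ∷ [] ⊢ y ≼ x :+ r })
        (ih x a) fb≤fa (ih b y) p
      bound {r} (Glue.backward p) = linear (f x ∷ f y ∷ f b ∷ f a ∷ dist D x b ∷ dist D a y ∷ r ∷ [])
        (λ { (x ∷ y ∷ a ∷ b ∷ xa ∷ by ∷ r ∷ []) → a ≼ x :+ xa ∷ b ≼ a ∷ y ≼ b :+ by ∷ xa :+ by ≼ r ∷ [] ⊢ y ≼ x :+ r })
        (ih x b) fa≤fb (ih a y) p

    -- A glued distance is a finite sum of distances of `d` and free crossings, so it is realised as
    -- soon as these are. In the application `Reach x y r` says that a path of length at most `r`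
    -- exists.
    glueAll-reach : ∀ (Reach : X → X → ℝ → Set) →
      (∀ {x y r s} → r ≤ s → Reach x y r → Reach x y s) →
      (∀ {x y z r s} → Reach x y r → Reach y z s → Reach x z (r + s)) →
      ∀ d → (∀ x y → Reach x y (dist d x y)) →
      ∀ W → (∀ {a b} → (a , b) ∈ₗ W → Reach a b 0# × Reach b a 0#) →
      ∀ x y → Reach x y (dist (glueAll d W) x y)
    glueAll-reach Reach weaken _◅◅_ d reach = go
      where
      go : ∀ W → (∀ {a b} → (a , b) ∈ₗ W → Reach a b 0# × Reach b a 0#) →
           ∀ x y → Reach x y (dist (glueAll d W) x y)
      go []            free x y = reach x y
      go ((a , b) ∷ W) free x y = along (Glue.route D a b x y)
        where
        D  = glueAll d W
        ih = go W (free ∘ there)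
        along : ∀ {r} → Glue.Route D a b x y r → Reach x y r
        along (Glue.direct   p) = weaken p (ih x y)
        along (Glue.forward  p) = weaken (≤-trans (≤-reflexive (+-congˡ (+-identityˡ _))) p)
          (ih x a ◅◅ (proj₁ (free (here ≡.refl)) ◅◅ ih b y))
        along (Glue.backward p) = weaken (≤-trans (≤-reflexive (+-congˡ (+-identityˡ _))) p)
          (ih x b ◅◅ (proj₂ (free (here ≡.refl)) ◅◅ ih a y))

    -- Arrival times of a front spreading through the pairs.

    module Spreading (d : PseudoMetric X) (F : X → ℝ) where

      -- The outcome of letting the front, which arrives at time `f` without the pairs, also use
      -- those in `W`. A source `(c , r)` is a point where the front starts afresh at time `r`. In
      -- the application `F` is the glued distance from the starting point, so `late` bounds the
      -- radii of the balls from above. `causal` says that events no earlier than `m` have no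
      -- effects before `m`; it is what makes the greedy choice correct.
      record Spread (f : X → ℝ) (W : List (X × X)) : Set where
        field
          arrival    : X → ℝ
          sources    : List (X × ℝ)
          #sources   : List.length sources ≡ List.length W
          lipschitz  : Lipschitz d arrival
          arrival≤   : ∀ y → arrival y ≤ f y
          consistent : Consistent arrival W
          covered    : ∀ y → f y ≤ arrival y ⊎ Any (λ { (c , r) → r + dist d c y ≤ arrival y }) sources
          started    : All (λ { (c , r) → r ≤ arrival c }) sources
          late       : ∑ (F ∘ proj₁) W ≤ ∑ proj₂ sources
          causal     : ∀ {m} → All (λ { (a , b) → m ≤ f a × m ≤ f b }) W → ∀ {y} → m ≤ f y → m ≤ arrival y
      open Spread

      spread-↭ : ∀ {f W W′} → W ↭ W′ → Spread f W′ → Spread f W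
      spread-↭ p S = record
        { arrival    = arrival S
        ; sources    = sources S
        ; #sources   = ≡.trans (#sources S) (≡.sym (↭-length p))
        ; lipschitz  = lipschitz S
        ; arrival≤   = arrival≤ S
        ; consistent = All-resp-↭ (↭-sym p) (consistent S)
        ; covered    = covered S
        ; started    = started S
        ; late       = ≤-respˡ-≈ (sym (∑-↭ _ p)) (late S)
        ; causal     = causal S ∘ All-resp-↭ p
        }

      -- Only `late` tells the two ends of a pair apart, since it counts the first one.
      spread-swap : ∀ {f a b W} → F a ≤ F b → Spread f ((b , a) ∷ W) → Spread f ((a , b) ∷ W)
      spread-swap Fa≤Fb S = record
        { arrival    = arrival S
        ; sources    = sources S
        ; #sources   = #sources S
        ; lipschitz  = lipschitz S
        ; arrival≤   = arrival≤ S
        ; consistent = (proj₂ (All.head (consistent S)) , proj₁ (All.head (consistent S))) ∷ All.tail (consistent S)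
        ; covered    = covered S
        ; started    = started S
        ; late       = ≤-trans (+-mono-≤ Fa≤Fb ≤-refl) (late S)
        ; causal     = λ { ((m≤a , m≤b) ∷ ms) → causal S ((m≤b , m≤a) ∷ ms) }
        }

      module Step {f : X → ℝ} (f-lip : Lipschitz d f) (a b : X) where

        relax : X → ℝ
        relax y = f y ⊓ (f a + dist d b y)

        relax-lipschitz : Lipschitz d relax
        relax-lipschitz x y with ⊓-sel (f x) (f a + dist d b x)
        ... | inj₁ eq = ≤-trans (x⊓y≤x _ _) (≤-respʳ-≈ (+-congʳ (sym eq)) (f-lip x y))
        ... | inj₂ eq = ≤-trans (x⊓y≤y _ _) (≤-respʳ-≈ (trans (sym (+-assoc _ _ _)) (+-congʳ (sym eq)))
                          (+-monoʳ-≤ _ (triangle d b x y)))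

        ≤relax : ∀ {m y} → m ≤ f a → m ≤ f y → m ≤ relax y
        ≤relax {m} {y} m≤fa m≤fy = ⊓-glb m≤fy
          (≤-respˡ-≈ (+-identityʳ m) (+-mono-≤ m≤fa (dist-nonNeg d b y)))

        -- No remaining pair is reached before time `f a`, so by `causal` nothing that happens later
        -- can lower the arrival at `a` or `b` below `f a`. Relaxing has already brought both down
        -- to `f a`, hence they agree for good.
        spread-∷ : ∀ {W} → F a ≤ f a → f a ≤ f b → All (λ { (a′ , b′) → f a ≤ f a′ × f a ≤ f b′ }) W →
                   Spread relax W → Spread f ((a , b) ∷ W)
        spread-∷ {W} Fa≤fa fa≤fb minimal S = record
          { arrival    = arrival S
          ; sources    = (b , f a) ∷ sources S
          ; #sources   = ≡.cong suc (#sources S)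
          ; lipschitz  = lipschitz S
          ; arrival≤   = λ y → ≤-trans (arrival≤ S y) (x⊓y≤x _ _)
          ; consistent = (≤-trans (≤-trans (arrival≤ S a) (x⊓y≤x _ _)) (fa≤arrival fa≤fb) ,
                          ≤-trans (≤-trans (arrival≤ S b) (≤-trans (x⊓y≤y _ _)
                            (≤-respʳ-≈ (+-identityʳ _) (+-monoʳ-≤ _ (dist-refl d b)))))
                            (fa≤arrival ≤-refl))
                         ∷ consistent S
          ; covered    = covered′
          ; started    = fa≤arrival fa≤fb ∷ started S
          ; late       = +-mono-≤ Fa≤fa (late S)
          ; causal     = λ { ((m≤fa , _) ∷ ms) m≤fy → causal S
                             (All.map (λ { (p , q) → ≤relax m≤fa p , ≤relax m≤fa q }) ms) (≤relax m≤fa m≤fy) }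
          }
          where
          fa≤arrival : ∀ {y} → f a ≤ f y → f a ≤ arrival S y
          fa≤arrival fa≤fy = causal S
            (All.map (λ { (p , q) → ≤relax ≤-refl p , ≤relax ≤-refl q }) minimal) (≤relax ≤-refl fa≤fy)

          covered′ : ∀ y → f y ≤ arrival S y ⊎
                     Any (λ { (c , r) → r + dist d c y ≤ arrival S y }) ((b , f a) ∷ sources S)
          covered′ y with covered S y | ⊓-sel (f y) (f a + dist d b y)
          ... | inj₂ i | _       = inj₂ (there i)
          ... | inj₁ p | inj₁ eq = inj₁ (≤-respˡ-≈ eq p)
          ... | inj₁ p | inj₂ eq = inj₂ (here (≤-respˡ-≈ eq p))

      abstract
        -- Dijkstra's algorithm: the pairs are crossed in the order of arrival, so
        -- that each of them creates one new source, at its later end.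
        spread : Lipschitz d F → ∀ n W → List.length W ≡ n → Consistent F W →
                 ∀ f → Lipschitz d f → (∀ y → F y ≤ f y) → Spread f W
        spread F-lip n       []      _  _   f f-lip F≤f = record
          { arrival    = f
          ; sources    = []
          ; #sources   = ≡.refl
          ; lipschitz  = f-lip
          ; arrival≤   = λ _ → ≤-refl
          ; consistent = []
          ; covered    = λ _ → inj₁ ≤-refl
          ; started    = []
          ; late       = ≤-refl
          ; causal     = λ _ m≤fy → m≤fy
          }
        -- The recursion is on the length, since taking out the earliest pair permutes the list.
        spread F-lip (suc n) (p ∷ W) len con f f-lip F≤f
          with extract-min (λ { (a , b) → f a ⊓ f b }) p W
        ... | (a , b) , rest , perm , minimal = spread-↭ perm (orient (≤-total (f a) (f b)))
          where
          Fab : F a ≤ F b × F b ≤ F a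
          Fab = All.head (All-resp-↭ perm con)

          continue : ∀ a b → F b ≤ F a → f a ≤ f b →
                     All (λ { (a′ , b′) → f a ≤ f a′ ⊓ f b′ }) rest → Spread f ((a , b) ∷ rest)
          continue a b Fb≤Fa fa≤fb first = spread-∷ (F≤f a) fa≤fb
            (All.map (λ h → ≤-trans h (x⊓y≤x _ _) , ≤-trans h (x⊓y≤y _ _)) first)
            (spread F-lip n rest (ℕ.suc-injective (≡.trans (≡.sym (↭-length perm)) len))
              (All.tail (All-resp-↭ perm con)) relax relax-lipschitz
              -- Relaxing does not undercut `F`, because `F` takes the same value at both ends of
              -- the pair.
              λ y → ⊓-glb (F≤f y) (≤-trans (F-lip b y) (+-mono-≤ (≤-trans Fb≤Fa (F≤f a)) ≤-refl)))
            where open Step f-lip a b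

          orient : f a ≤ f b ⊎ f b ≤ f a → Spread f ((a , b) ∷ rest)
          orient (inj₁ fa≤fb) = continue a b (proj₂ Fab) fa≤fb
            (All.map (≤-trans (⊓-glb ≤-refl fa≤fb)) minimal)
          orient (inj₂ fb≤fa) = spread-swap (proj₁ Fab) (continue b a (proj₁ Fab) fb≤fa
            (All.map (≤-trans (⊓-glb fb≤fa ≤-refl)) minimal))

-- The total length of intervals that cover a segment.

module Circle (R : CompleteOrderedField) where
  open OrderedField R
  open Gluing R

  Interval : Set
  Interval = ℝ × ℝ

  Proper : Interval → Set
  Proper (lo , hi) = lo ≤ hi

  _∈ᴵ_ : ℝ → Interval → Set
  t ∈ᴵ (lo , hi) = lo ≤ t × t ≤ hi

  width : Interval → ℝ
  width (lo , hi) = hi - lo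

  clamp : ℝ → Interval → ℝ
  clamp t (lo , hi) = lo ⊔ (t ⊓ hi)

  clamp-mono : ∀ {s t} → s ≤ t → ∀ I → clamp s I ≤ clamp t I
  clamp-mono s≤t (lo , hi) = ⊔-lub (x≤x⊔y _ _)
    (≤-trans (⊓-glb (≤-trans (x⊓y≤x _ _) s≤t) (x⊓y≤y _ _)) (x≤y⊔x _ _))

  ∑-mono : ∀ {A : Set} {f g : A → ℝ} → (∀ x → f x ≤ g x) → ∀ xs → ∑ f xs ≤ ∑ g xs
  ∑-mono f≤g []       = ≤-refl
  ∑-mono f≤g (x ∷ xs) = +-mono-≤ (f≤g x) (∑-mono f≤g xs)

  -- The two maxima are `hi` and `lo` moved into [p, q]; their difference is the length of the part
  -- of the interval that lies in [p, q], and this is what the clamp gains from `p` to `q`.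
  clamp-step : ∀ {p q} ((lo , hi) : Interval) → p ≤ q →
               (p ⊔ (q ⊓ hi)) + clamp p (lo , hi) ≤ (p ⊔ (q ⊓ lo)) + clamp q (lo , hi)
  clamp-step {p} {q} (lo , hi) p≤q with ⊔-sel p (q ⊓ hi) | ⊔-sel lo (p ⊓ hi) | q ≤? lo
  ... | inj₁ v≈p  | _          | _ =
    +-mono-≤ (≤-respˡ-≈ (sym v≈p) (x≤x⊔y p (q ⊓ lo))) (clamp-mono p≤q (lo , hi))
  ... | inj₂ v≈qh | inj₂ cl≈ph | _ = ≤-trans (≤-reflexive (+-comm _ _))
    (+-mono-≤ (≤-respˡ-≈ (sym cl≈ph) (≤-trans (x⊓y≤x p hi) (x≤x⊔y p (q ⊓ lo))))
              (≤-respˡ-≈ (sym v≈qh) (x≤y⊔x lo (q ⊓ hi))))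
  ... | inj₂ v≈qh | inj₁ cl≈lo | yes q≤lo =
    +-mono-≤ (≤-respˡ-≈ (sym v≈qh) (≤-trans (x⊓y≤x q hi) (≤-trans (⊓-glb ≤-refl q≤lo) (x≤y⊔x _ _))))
             (≤-respˡ-≈ (sym cl≈lo) (x≤x⊔y _ _))
  ... | inj₂ v≈qh | inj₁ cl≈lo | no q≰lo = ≤-trans (≤-reflexive (+-comm _ _))
    (+-mono-≤ (≤-respˡ-≈ (sym cl≈lo) (≤-trans (⊓-glb (≰⇒≥ q≰lo) ≤-refl) (x≤y⊔x _ _)))
              (≤-respˡ-≈ (sym v≈qh) (x≤y⊔x _ _)))

  -- clamp t (lo , hi) increases with slope 1 on the interval and is constant outside,
  -- so ∑ (clamp t) Is - t is nondecreasing as long as t stays in the cover.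
  covered-length : ∀ Is {p q} → p ≤ q → All Proper Is →
                   (∀ t → ¬ t ≤ p → ¬ q ≤ t → Any (t ∈ᴵ_) Is) →
                   q + ∑ (clamp p) Is ≤ p + ∑ (clamp q) Is
  covered-length [] {p} {q} p≤q [] covered = +-mono-≤ (≤-by-cases (q ≤? p)) ≤-refl
    where
    m : ℝ
    -- With no interval left, any point strictly between `p` and `q` would be uncovered; the
    -- midpoint is one.
    m = half (p + q)
    2m : m + m ≈ p + q
    2m = half+half (p + q)
    ≤-by-cases : Dec (q ≤ p) → q ≤ p
    ≤-by-cases (yes q≤p) = q≤p
    ≤-by-cases (no  q≰p) with covered m
      (λ m≤p → q≰p (linear (m ∷ p ∷ q ∷ []) (λ { (m ∷ p ∷ q ∷ []) → m ≼ p ∷ m ≼ p ∷ p :+ q ≼ m :+ m ∷ [] ⊢ q ≼ p }) m≤p m≤p (≤-reflexive (sym 2m))))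
      (λ q≤m → q≰p (linear (m ∷ p ∷ q ∷ []) (λ { (m ∷ p ∷ q ∷ []) → q ≼ m ∷ q ≼ m ∷ m :+ m ≼ p :+ q ∷ [] ⊢ q ≼ p }) q≤m q≤m (≤-reflexive 2m)))
    ... | ()
  covered-length ((lo , hi) ∷ Is) {p} {q} p≤q (lo≤hi ∷ proper) covered = linear
    (p ∷ q ∷ u ∷ v ∷ clamp p (lo , hi) ∷ clamp q (lo , hi) ∷
      ∑ (clamp p) Is ∷ ∑ (clamp u) Is ∷ ∑ (clamp v) Is ∷ ∑ (clamp q) Is ∷ [])
    (λ { (p ∷ q ∷ u ∷ v ∷ cp ∷ cq ∷ Σp ∷ Σu ∷ Σv ∷ Σq ∷ []) →
      u :+ Σp ≼ p :+ Σu ∷ q :+ Σv ≼ v :+ Σq ∷ Σu ≼ Σv ∷ v :+ cp ≼ u :+ cq ∷ [] ⊢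
      q :+ (cp :+ Σp) ≼ p :+ (cq :+ Σq) })
    (covered-length Is p≤u proper left) (covered-length Is v≤q proper right)
    (∑-mono (clamp-mono u≤v) Is) (clamp-step (lo , hi) p≤q)
    where
    u v : ℝ
    -- Cutting the interval out of [p, q] leaves [p, u] and [v, q], which the remaining intervals
    -- must cover; across [u, v] their clamps can only increase.
    u = p ⊔ (q ⊓ lo)
    v = p ⊔ (q ⊓ hi)

    p≤u : p ≤ u
    p≤u = x≤x⊔y _ _

    u≤q : u ≤ q
    u≤q = ⊔-lub p≤q (x⊓y≤x _ _)

    v≤q : v ≤ q
    v≤q = ⊔-lub p≤q (x⊓y≤x _ _)

    u≤v : u ≤ v
    u≤v = ⊔-lub (x≤x⊔y _ _) (≤-trans (⊓-glb (x⊓y≤x _ _) (≤-trans (x⊓y≤y _ _) lo≤hi)) (x≤y⊔x _ _))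

    left : ∀ t → ¬ t ≤ p → ¬ u ≤ t → Any (t ∈ᴵ_) Is
    left t t≰p u≰t with covered t t≰p (λ q≤t → u≰t (≤-trans u≤q q≤t))
    ... | here (lo≤t , _) = ⊥-elim (u≰t (⊔-lub (≰⇒≥ t≰p) (≤-trans (x⊓y≤y _ _) lo≤t)))
    ... | there i         = i

    right : ∀ t → ¬ t ≤ v → ¬ q ≤ t → Any (t ∈ᴵ_) Is
    right t t≰v q≰t with covered t (λ t≤p → t≰v (≤-trans t≤p (x≤x⊔y _ _))) q≰t
    ... | here (_ , t≤hi) = ⊥-elim (t≰v (≤-trans (⊓-glb (≰⇒≥ q≰t) t≤hi) (x≤y⊔x _ _)))
    ... | there i         = i

  clamp-width : ∀ p q Is → All Proper Is → ∑ (clamp q) Is ≤ ∑ (clamp p) Is + ∑ width Is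
  clamp-width p q []               []               = ≤-reflexive (sym (+-identityˡ 0#))
  clamp-width p q ((lo , hi) ∷ Is) (lo≤hi ∷ proper) = linear
    (lo ∷ hi ∷ clamp p (lo , hi) ∷ clamp q (lo , hi) ∷ ∑ (clamp p) Is ∷ ∑ (clamp q) Is ∷ ∑ width Is ∷ [])
    (λ { (lo ∷ hi ∷ cp ∷ cq ∷ Σp ∷ Σq ∷ W ∷ []) → cq ≼ hi ∷ lo ≼ cp ∷ Σq ≼ Σp :+ W ∷ [] ⊢
      cq :+ Σq ≼ (cp :+ Σp) :+ ((hi :- lo) :+ W) })
    (⊔-lub lo≤hi (x⊓y≤y _ _)) (x≤x⊔y _ _) (clamp-width p q Is proper)

  -- The circle as the segment [0, L] with distance zero between its ends.

  module Arc {L : ℝ} (0≤L : 0# ≤ L) where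

    arc : ℝ → ℝ → ℝ
    arc s t = ∣ s - t ∣ ⊓ (L - ∣ s - t ∣)

    record Intervals (P : ℝ → Set) (total : ℝ) : Set where
      field
        intervals : List Interval
        proper    : All Proper intervals
        total≤    : ∑ width intervals ≤ total
        covering  : ∀ {t} → Within L t → P t → Any (t ∈ᴵ_) intervals
    open Intervals

    data Near (c ρ t : ℝ) : Set where
      straight : c - t ≤ ρ → t - c ≤ ρ → Near c ρ t
      around⁻  : L - ρ ≤ c - t → Near c ρ t
      around⁺  : L - ρ ≤ t - c → Near c ρ t

    arc≤⇒Near : ∀ {c ρ t} → arc c t ≤ ρ → Near c ρ t
    arc≤⇒Near {c} {ρ} {t} p with ⊓-sel ∣ c - t ∣ (L - ∣ c - t ∣)
    ... | inj₁ eq = straight (≤-trans (x-y≤∣x-y∣ c t) (≤-respˡ-≈ eq p)) (≤-trans (y-x≤∣x-y∣ c t) (≤-respˡ-≈ eq p))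
    ... | inj₂ eq with ⊔-sel (c - t) (t - c)
    ...   | inj₁ eq′ = around⁻ (≤-respʳ-≈ eq′ (linear (∣ c - t ∣ ∷ L ∷ ρ ∷ [])
                         (λ { (a ∷ L ∷ ρ ∷ []) → L :- a ≼ ρ ∷ [] ⊢ L :- ρ ≼ a }) (≤-respˡ-≈ eq p)))
    ...   | inj₂ eq′ = around⁺ (≤-respʳ-≈ eq′ (linear (∣ c - t ∣ ∷ L ∷ ρ ∷ [])
                         (λ { (a ∷ L ∷ ρ ∷ []) → L :- a ≼ ρ ∷ [] ⊢ L :- ρ ≼ a }) (≤-respˡ-≈ eq p)))

    -- Cut open at 0, the ball is an interval, or it sticks out at one end and the overhang
    -- reappears at the other end as a second interval. The intervals are not trimmed to [0, L] and
    -- may overlap, so their total width is 2 ρ in every case.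
    ball : ∀ {c ρ} → Within L c → 0# ≤ ρ → Intervals (λ t → arc c t ≤ ρ) (ρ + ρ)
    ball {c} {ρ} (0≤c , c≤L) 0≤ρ with c ≤? ρ | L ≤? (c + ρ)
    ... | yes c≤ρ | _ = record
      { intervals = (0# , c + ρ) ∷ (c - ρ + L , L) ∷ []
      ; proper    = linear (c ∷ ρ ∷ []) (λ { (c ∷ ρ ∷ []) → :0 ≼ c ∷ :0 ≼ ρ ∷ [] ⊢ :0 ≼ c :+ ρ }) 0≤c 0≤ρ
                  ∷ linear (c ∷ ρ ∷ L ∷ []) (λ { (c ∷ ρ ∷ L ∷ []) → c ≼ ρ ∷ [] ⊢ c :- ρ :+ L ≼ L }) c≤ρ ∷ []
      ; total≤    = linear (c ∷ ρ ∷ L ∷ []) λ { (c ∷ ρ ∷ L ∷ []) →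
                      [] ⊢ (c :+ ρ :- :0) :+ ((L :- (c :- ρ :+ L)) :+ :0) ≼ ρ :+ ρ }
      ; covering  = λ t∈ near → cover t∈ (arc≤⇒Near near)
      }
      where
      cover : ∀ {t} → Within L t → Near c ρ t → Any (t ∈ᴵ_) ((0# , c + ρ) ∷ (c - ρ + L , L) ∷ [])
      cover {t} (0≤t , t≤L) (straight p q) = here (0≤t ,
        linear (t ∷ c ∷ ρ ∷ []) (λ { (t ∷ c ∷ ρ ∷ []) → t :- c ≼ ρ ∷ [] ⊢ t ≼ c :+ ρ }) q)
      cover {t} (0≤t , t≤L) (around⁻ p) = here (0≤t ,
        linear (t ∷ c ∷ ρ ∷ L ∷ []) (λ { (t ∷ c ∷ ρ ∷ L ∷ []) → L :- ρ ≼ c :- t ∷ :0 ≼ L ∷ [] ⊢ t ≼ c :+ ρ }) p 0≤L)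
      cover {t} (0≤t , t≤L) (around⁺ p) = there (here (
        linear (t ∷ c ∷ ρ ∷ L ∷ []) (λ { (t ∷ c ∷ ρ ∷ L ∷ []) → L :- ρ ≼ t :- c ∷ [] ⊢ c :- ρ :+ L ≼ t }) p , t≤L))
    ... | no _ | yes L≤c+ρ = record
      { intervals = (c - ρ , L) ∷ (0# , c + ρ - L) ∷ []
      ; proper    = linear (c ∷ ρ ∷ L ∷ []) (λ { (c ∷ ρ ∷ L ∷ []) → c ≼ L ∷ :0 ≼ ρ ∷ [] ⊢ c :- ρ ≼ L }) c≤L 0≤ρ
                  ∷ linear (c ∷ ρ ∷ L ∷ []) (λ { (c ∷ ρ ∷ L ∷ []) → L ≼ c :+ ρ ∷ [] ⊢ :0 ≼ c :+ ρ :- L }) L≤c+ρ ∷ []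
      ; total≤    = linear (c ∷ ρ ∷ L ∷ []) λ { (c ∷ ρ ∷ L ∷ []) →
                      [] ⊢ (L :- (c :- ρ)) :+ ((c :+ ρ :- L :- :0) :+ :0) ≼ ρ :+ ρ }
      ; covering  = λ t∈ near → cover t∈ (arc≤⇒Near near)
      }
      where
      cover : ∀ {t} → Within L t → Near c ρ t → Any (t ∈ᴵ_) ((c - ρ , L) ∷ (0# , c + ρ - L) ∷ [])
      cover {t} (0≤t , t≤L) (straight p q) = here (
        linear (t ∷ c ∷ ρ ∷ []) (λ { (t ∷ c ∷ ρ ∷ []) → c :- t ≼ ρ ∷ [] ⊢ c :- ρ ≼ t }) p , t≤L)
      cover {t} (0≤t , t≤L) (around⁻ p) = there (here (0≤t ,
        linear (t ∷ c ∷ ρ ∷ L ∷ []) (λ { (t ∷ c ∷ ρ ∷ L ∷ []) → L :- ρ ≼ c :- t ∷ [] ⊢ t ≼ c :+ ρ :- L }) p))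
      cover {t} (0≤t , t≤L) (around⁺ p) = here (
        linear (t ∷ c ∷ ρ ∷ L ∷ []) (λ { (t ∷ c ∷ ρ ∷ L ∷ []) → L :- ρ ≼ t :- c ∷ :0 ≼ L ∷ [] ⊢ c :- ρ ≼ t }) p 0≤L , t≤L)
    ... | no c≰ρ | no L≰c+ρ = record
      { intervals = (c - ρ , c + ρ) ∷ []
      ; proper    = linear (c ∷ ρ ∷ []) (λ { (c ∷ ρ ∷ []) → :0 ≼ ρ ∷ :0 ≼ ρ ∷ [] ⊢ c :- ρ ≼ c :+ ρ }) 0≤ρ 0≤ρ ∷ []
      ; total≤    = linear (c ∷ ρ ∷ []) λ { (c ∷ ρ ∷ []) → [] ⊢ (c :+ ρ :- (c :- ρ)) :+ :0 ≼ ρ :+ ρ }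
      ; covering  = λ t∈ near → here (cover t∈ (arc≤⇒Near near))
      }
      where
      cover : ∀ {t} → Within L t → Near c ρ t → t ∈ᴵ (c - ρ , c + ρ)
      cover {t} (0≤t , t≤L) (straight p q) =
        linear (t ∷ c ∷ ρ ∷ []) (λ { (t ∷ c ∷ ρ ∷ []) → c :- t ≼ ρ ∷ [] ⊢ c :- ρ ≼ t }) p ,
        linear (t ∷ c ∷ ρ ∷ []) (λ { (t ∷ c ∷ ρ ∷ []) → t :- c ≼ ρ ∷ [] ⊢ t ≼ c :+ ρ }) q
      cover {t} (0≤t , t≤L) (around⁻ p) = ⊥-elim (L≰c+ρ (
        linear (t ∷ c ∷ ρ ∷ L ∷ []) (λ { (t ∷ c ∷ ρ ∷ L ∷ []) → L :- ρ ≼ c :- t ∷ :0 ≼ t ∷ [] ⊢ L ≼ c :+ ρ }) p 0≤t))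
      cover {t} (0≤t , t≤L) (around⁺ p) = ⊥-elim (c≰ρ (
        linear (t ∷ c ∷ ρ ∷ L ∷ []) (λ { (t ∷ c ∷ ρ ∷ L ∷ []) → L :- ρ ≼ t :- c ∷ t ≼ L ∷ [] ⊢ c ≼ ρ }) p t≤L))

    module _ {A : Set} (center radius : A → ℝ) where

      balls : ∀ Bs → All (λ B → Within L (center B) × 0# ≤ radius B) Bs →
              Intervals (λ t → Any (λ B → arc (center B) t ≤ radius B) Bs) (∑ (λ B → radius B + radius B) Bs)
      balls []       []               = record
        { intervals = [] ; proper = [] ; total≤ = ≤-refl ; covering = λ { _ () } }
      balls (B ∷ Bs) ((c∈ , 0≤ρ) ∷ ok) = record
        { intervals = intervals I ++ intervals Is
        ; proper    = All.++⁺ (proper I) (proper Is)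
        ; total≤    = ≤-respˡ-≈ (sym (∑-++ width (intervals I) (intervals Is))) (+-mono-≤ (total≤ I) (total≤ Is))
        ; covering  = λ { t∈ (here p)  → Any.++⁺ˡ (covering I t∈ p)
                        ; t∈ (there p) → Any.++⁺ʳ (intervals I) (covering Is t∈ p) }
        }
        where
        I  = ball c∈ 0≤ρ
        Is = balls Bs ok

      -- The sum of the clamps increases from 0 to L by at least L, as the intervals cover, and by
      -- at most their total width.
      balls-cover : ∀ Bs → All (λ B → Within L (center B) × 0# ≤ radius B) Bs →
                    (∀ {t} → Within L t → Any (λ B → arc (center B) t ≤ radius B) Bs) →
                    L ≤ ∑ (λ B → radius B + radius B) Bs
      balls-cover Bs ok cover = linear
        (L ∷ ∑ (clamp 0#) (intervals I) ∷ ∑ (clamp L) (intervals I) ∷ ∑ width (intervals I) ∷ _ ∷ [])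
        (λ { (L ∷ c0 ∷ cL ∷ W ∷ T ∷ []) → L :+ c0 ≼ :0 :+ cL ∷ cL ≼ c0 :+ W ∷ W ≼ T ∷ [] ⊢ L ≼ T })
        (covered-length (intervals I) 0≤L (proper I)
          λ t t≰0 L≰t → let t∈ = ≰⇒≥ t≰0 , ≰⇒≥ L≰t in covering I t∈ (cover t∈))
        (clamp-width 0# L (intervals I) (proper I)) (total≤ I)
        where
        I = balls Bs ok

    arc-refl : ∀ s → arc s s ≤ 0#
    arc-refl s = ≤-trans (x⊓y≤x _ _) (∣x-y∣≤ s-s≤0 s-s≤0)
      where
      s-s≤0 : s - s ≤ 0#
      s-s≤0 = ≤-reflexive (-‿inverseʳ s)

    ∣-∣-comm : ∀ s t → ∣ s - t ∣ ≤ ∣ t - s ∣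
    ∣-∣-comm s t = ∣x-y∣≤ (y-x≤∣x-y∣ t s) (x-y≤∣x-y∣ t s)

    arc-sym : ∀ s t → arc s t ≤ arc t s
    arc-sym s t = ⊓-glb (≤-trans (x⊓y≤x _ _) (∣-∣-comm s t))
      (≤-trans (x⊓y≤y _ _) (linear (L ∷ ∣ s - t ∣ ∷ ∣ t - s ∣ ∷ [])
        (λ { (L ∷ a ∷ b ∷ []) → b ≼ a ∷ [] ⊢ L :- a ≼ L :- b }) (∣-∣-comm t s)))

    ∣-∣-triangle : ∀ r s t → ∣ r - t ∣ ≤ ∣ r - s ∣ + ∣ s - t ∣
    ∣-∣-triangle r s t = ∣x-y∣≤
      (linear (r ∷ s ∷ t ∷ ∣ r - s ∣ ∷ ∣ s - t ∣ ∷ [])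
        (λ { (r ∷ s ∷ t ∷ a ∷ b ∷ []) → r :- s ≼ a ∷ s :- t ≼ b ∷ [] ⊢ r :- t ≼ a :+ b })
        (x-y≤∣x-y∣ r s) (x-y≤∣x-y∣ s t))
      (linear (r ∷ s ∷ t ∷ ∣ r - s ∣ ∷ ∣ s - t ∣ ∷ [])
        (λ { (r ∷ s ∷ t ∷ a ∷ b ∷ []) → s :- r ≼ a ∷ t :- s ≼ b ∷ [] ⊢ t :- r ≼ a :+ b })
        (y-x≤∣x-y∣ r s) (y-x≤∣x-y∣ s t))

    -- Needed for `arc-triangle` when both arcs go the long way round. Among the eight sign patterns
    -- the two cyclic ones sum to zero, and each of the others is twice a single difference.
    perimeter : ∀ {r s t} → Within L r → Within L s → Within L t →
                ∣ r - t ∣ + (∣ r - s ∣ + ∣ s - t ∣) ≤ L + L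
    perimeter {r} {s} {t} (0≤r , r≤L) (0≤s , s≤L) (0≤t , t≤L) =
      on r t (λ v → v + (∣ r - s ∣ + ∣ s - t ∣)) +-congʳ
        (on r s (λ v → (r - t) + (v + ∣ s - t ∣)) (+-congˡ ∘ +-congʳ)
          (on s t (λ v → (r - t) + ((r - s) + v)) (+-congˡ ∘ +-congˡ)
            (linear ρ (λ { (r ∷ s ∷ t ∷ L ∷ []) → r ≼ L ∷ r ≼ L ∷ :0 ≼ t ∷ :0 ≼ t ∷ [] ⊢ (r :- t) :+ ((r :- s) :+ (s :- t)) ≼ L :+ L }) r≤L r≤L 0≤t 0≤t)
            (linear ρ (λ { (r ∷ s ∷ t ∷ L ∷ []) → r ≼ L ∷ r ≼ L ∷ :0 ≼ s ∷ :0 ≼ s ∷ [] ⊢ (r :- t) :+ ((r :- s) :+ (t :- s)) ≼ L :+ L }) r≤L r≤L 0≤s 0≤s))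
          (on s t (λ v → (r - t) + ((s - r) + v)) (+-congˡ ∘ +-congˡ)
            (linear ρ (λ { (r ∷ s ∷ t ∷ L ∷ []) → s ≼ L ∷ s ≼ L ∷ :0 ≼ t ∷ :0 ≼ t ∷ [] ⊢ (r :- t) :+ ((s :- r) :+ (s :- t)) ≼ L :+ L }) s≤L s≤L 0≤t 0≤t)
            (linear ρ (λ { (r ∷ s ∷ t ∷ L ∷ []) → :0 ≼ L ∷ :0 ≼ L ∷ [] ⊢ (r :- t) :+ ((s :- r) :+ (t :- s)) ≼ L :+ L }) 0≤L 0≤L)))
        (on r s (λ v → (t - r) + (v + ∣ s - t ∣)) (+-congˡ ∘ +-congʳ)
          (on s t (λ v → (t - r) + ((r - s) + v)) (+-congˡ ∘ +-congˡ)
            (linear ρ (λ { (r ∷ s ∷ t ∷ L ∷ []) → :0 ≼ L ∷ :0 ≼ L ∷ [] ⊢ (t :- r) :+ ((r :- s) :+ (s :- t)) ≼ L :+ L }) 0≤L 0≤L)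
            (linear ρ (λ { (r ∷ s ∷ t ∷ L ∷ []) → t ≼ L ∷ t ≼ L ∷ :0 ≼ s ∷ :0 ≼ s ∷ [] ⊢ (t :- r) :+ ((r :- s) :+ (t :- s)) ≼ L :+ L }) t≤L t≤L 0≤s 0≤s))
          (on s t (λ v → (t - r) + ((s - r) + v)) (+-congˡ ∘ +-congˡ)
            (linear ρ (λ { (r ∷ s ∷ t ∷ L ∷ []) → s ≼ L ∷ s ≼ L ∷ :0 ≼ r ∷ :0 ≼ r ∷ [] ⊢ (t :- r) :+ ((s :- r) :+ (s :- t)) ≼ L :+ L }) s≤L s≤L 0≤r 0≤r)
            (linear ρ (λ { (r ∷ s ∷ t ∷ L ∷ []) → t ≼ L ∷ t ≼ L ∷ :0 ≼ r ∷ :0 ≼ r ∷ [] ⊢ (t :- r) :+ ((s :- r) :+ (t :- s)) ≼ L :+ L }) t≤L t≤L 0≤r 0≤r)))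
      where
      ρ = r ∷ s ∷ t ∷ L ∷ []
      on : ∀ x y (ctx : ℝ → ℝ) → (∀ {a b} → a ≈ b → ctx a ≈ ctx b) →
           ctx (x - y) ≤ L + L → ctx (y - x) ≤ L + L → ctx ∣ x - y ∣ ≤ L + L
      on x y ctx cong = ∣-∣-cases (λ v → ctx v ≤ L + L) (λ a≈b → ≤-respˡ-≈ (cong a≈b)) x y

    arc-triangle : ∀ {r s t} → Within L r → Within L s → Within L t → arc r t ≤ arc r s + arc s t
    arc-triangle {r} {s} {t} r∈ s∈ t∈
      with ⊓-sel ∣ r - s ∣ (L - ∣ r - s ∣) | ⊓-sel ∣ s - t ∣ (L - ∣ s - t ∣)
    ... | inj₁ e | inj₁ e′ = ≤-trans (x⊓y≤x _ _) (≤-respʳ-≈ (sym (+-cong e e′)) (∣-∣-triangle r s t))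
    ... | inj₁ e | inj₂ e′ = ≤-trans (x⊓y≤y _ _) (≤-respʳ-≈ (sym (+-cong e e′))
      (linear (L ∷ ∣ r - s ∣ ∷ ∣ s - t ∣ ∷ ∣ r - t ∣ ∷ ∣ s - r ∣ ∷ [])
        (λ { (L ∷ rs ∷ st ∷ rt ∷ sr ∷ []) → st ≼ sr :+ rt ∷ sr ≼ rs ∷ [] ⊢ L :- rt ≼ rs :+ (L :- st) })
        (∣-∣-triangle s r t) (∣-∣-comm s r)))
    ... | inj₂ e | inj₁ e′ = ≤-trans (x⊓y≤y _ _) (≤-respʳ-≈ (sym (+-cong e e′))
      (linear (L ∷ ∣ r - s ∣ ∷ ∣ s - t ∣ ∷ ∣ r - t ∣ ∷ ∣ t - s ∣ ∷ [])
        (λ { (L ∷ rs ∷ st ∷ rt ∷ ts ∷ []) → rs ≼ rt :+ ts ∷ ts ≼ st ∷ [] ⊢ L :- rt ≼ (L :- rs) :+ st })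
        (∣-∣-triangle r t s) (∣-∣-comm t s)))
    ... | inj₂ e | inj₂ e′ = ≤-trans (x⊓y≤x _ _) (≤-respʳ-≈ (sym (+-cong e e′))
      (linear (L ∷ ∣ r - s ∣ ∷ ∣ s - t ∣ ∷ ∣ r - t ∣ ∷ [])
        (λ { (L ∷ rs ∷ st ∷ rt ∷ []) → rt :+ (rs :+ st) ≼ L :+ L ∷ [] ⊢ rt ≼ (L :- rs) :+ (L :- st) })
        (perimeter r∈ s∈ t∈)))

-- The glued circle: its diameter is attained and bounded below.

module WormholeMetric (R : CompleteOrderedField) where
  open OrderedField R
  open Gluing R

  open Circle R

  module Wormholes {L : ℝ} (0≤L : 0# ≤ L) {X : Set} (pos : X → ℝ) (pos∈ : ∀ x → Within L (pos x)) where
    open PseudoMetric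
    open Arc 0≤L

    circle : PseudoMetric X
    circle .dist x y       = arc (pos x) (pos y)
    circle .dist-refl x    = arc-refl (pos x)
    circle .dist-sym x y   = arc-sym (pos x) (pos y)
    circle .triangle x y z = arc-triangle (pos∈ x) (pos∈ y) (pos∈ z)

    -- `at` inverts `pos` only up to arc length zero: the point at L may be the one with position 0.
    module _ (at : ℝ → X) (pos-at : ∀ {t} → Within L t → arc (pos (at t)) t ≤ 0#) (W : List (X × X)) where

      D : PseudoMetric X
      D = glueAll circle W

      D-at-pos : ∀ x → dist D x (at (pos x)) ≤ 0#
      D-at-pos x = ≤-trans (glueAll≤ circle W _ _) (≤-trans (arc-sym _ _) (pos-at (pos∈ x)))

      D-at : ∀ {s t} → Within L s → Within L t → dist D (at s) (at t) ≤ ∣ s - t ∣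
      D-at {s} {t} s∈ t∈ = ≤-trans (glueAll≤ circle W _ _) (linear
        (arc s′ t′ ∷ arc s′ s ∷ arc s t′ ∷ arc s t ∷ arc t t′ ∷ arc t′ t ∷ ∣ s - t ∣ ∷ [])
        (λ { (s′t′ ∷ s′s ∷ st′ ∷ st ∷ tt′ ∷ t′t ∷ d ∷ []) →
          s′t′ ≼ s′s :+ st′ ∷ st′ ≼ st :+ tt′ ∷ s′s ≼ :0 ∷ tt′ ≼ t′t ∷ t′t ≼ :0 ∷ st ≼ d ∷ [] ⊢ s′t′ ≼ d })
        (arc-triangle (pos∈ _) s∈ (pos∈ _)) (arc-triangle s∈ t∈ (pos∈ _))
        (pos-at s∈) (arc-sym _ _) (pos-at t∈) (x⊓y≤x _ _))
        where
        s′ = pos (at s)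
        t′ = pos (at t)

      abstract
        -- Two maxima over [0, L] in succession: first the farthest point for each `s`, then the
        -- largest eccentricity `e s`, which is again 1-Lipschitz by the triangle inequality. Every
        -- point is at distance zero from some `at t`, so nothing is missed.
        diameter : ∃₂ λ x y → ∀ u v → dist D u v ≤ dist D x y
        diameter = at s₀ , at (farthest s₀) , λ u v → linear
          (dist D u v ∷ dist D u (at (pos u)) ∷ dist D (at (pos u)) v ∷ h (pos u) (pos v) ∷ dist D (at (pos v)) v ∷
            dist D v (at (pos v)) ∷ e (pos u) ∷ e s₀ ∷ [])
          (λ { (uv ∷ uu′ ∷ u′v ∷ u′v′ ∷ v′v ∷ vv′ ∷ eu ∷ es ∷ []) →
            uv ≼ uu′ :+ u′v ∷ u′v ≼ u′v′ :+ v′v ∷ uu′ ≼ :0 ∷ v′v ≼ vv′ ∷ vv′ ≼ :0 ∷ u′v′ ≼ eu ∷ eu ≼ es ∷ [] ⊢ uv ≼ es })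
          (triangle D u (at (pos u)) v) (triangle D (at (pos u)) (at (pos v)) v)
          (D-at-pos u) (dist-sym D _ _) (D-at-pos v) (h≤e (pos u) (pos∈ v)) (e≤e (pos∈ u))
          where
          h : ℝ → ℝ → ℝ
          h s t = dist D (at s) (at t)

          abstract
            farthest-from : ∀ s → ∃ λ c → Within L c × (∀ {t} → Within L t → h s t ≤ h s c)
            farthest-from s = maximum 0≤L (h s) λ {t} {t′} t∈ t′∈ → linear
              (h s t ∷ h s t′ ∷ h t′ t ∷ h t t′ ∷ ∣ t - t′ ∣ ∷ [])
              (λ { (st ∷ st′ ∷ t′t ∷ tt′ ∷ d ∷ []) → st ≼ st′ :+ t′t ∷ t′t ≼ tt′ ∷ tt′ ≼ d ∷ [] ⊢ st ≼ st′ :+ d })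
              (triangle D _ _ _) (dist-sym D _ _) (D-at t∈ t′∈)

          farthest : ℝ → ℝ
          farthest s = proj₁ (farthest-from s)

          e : ℝ → ℝ
          e s = h s (farthest s)

          h≤e : ∀ s {t} → Within L t → h s t ≤ e s
          h≤e s = proj₂ (proj₂ (farthest-from s))

          most-eccentric : ∃ λ c → Within L c × (∀ {t} → Within L t → e t ≤ e c)
          most-eccentric = maximum 0≤L e λ {s} {s′} s∈ s′∈ → linear
            (e s ∷ h s s′ ∷ h s′ (farthest s) ∷ e s′ ∷ ∣ s - s′ ∣ ∷ [])
            (λ { (es ∷ ss′ ∷ s′c ∷ es′ ∷ d ∷ []) → es ≼ ss′ :+ s′c ∷ ss′ ≼ d ∷ s′c ≼ es′ ∷ [] ⊢ es ≼ es′ :+ d })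
            (triangle D _ _ _) (D-at s∈ s′∈) (h≤e s′ (proj₁ (proj₂ (farthest-from s))))

          s₀ : ℝ
          s₀ = proj₁ most-eccentric

          e≤e : ∀ {t} → Within L t → e t ≤ e s₀
          e≤e {t} = proj₂ (proj₂ most-eccentric) {t}

      ∑-radii : ∀ Δ (T : List (X × ℝ)) →
                ∑ (λ B → (Δ - proj₂ B) + (Δ - proj₂ B)) T + (∑ proj₂ T + ∑ proj₂ T) ≤ List.length T · Δ + List.length T · Δ
      ∑-radii Δ []            = linear [] λ { [] → [] ⊢ :0 :+ (:0 :+ :0) ≼ :0 :+ :0 }
      ∑-radii Δ ((c , r) ∷ T) = linear
        (Δ ∷ r ∷ ∑ (λ B → (Δ - proj₂ B) + (Δ - proj₂ B)) T ∷ ∑ proj₂ T ∷ List.length T · Δ ∷ [])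
        (λ { (Δ ∷ r ∷ s ∷ rs ∷ k ∷ []) → s :+ (rs :+ rs) ≼ k :+ k ∷ [] ⊢
          (((Δ :- r) :+ (Δ :- r)) :+ s) :+ ((r :+ rs) :+ (r :+ rs)) ≼ (Δ :+ k) :+ (Δ :+ k) })
        (∑-radii Δ T)

      -- The circle is covered by the balls of radius Δ around x and Δ - r
      -- around the sources (c , r), one for each wormhole.
      growth : ∀ x Δ → (∀ y → dist D x y ≤ Δ) →
               L + (∑ (dist D x ∘ proj₁) W + ∑ (dist D x ∘ proj₁) W) ≤
               (Δ + Δ) + (List.length W · Δ + List.length W · Δ)
      growth x Δ D≤Δ = linear
        (L ∷ Δ ∷ ∑ (dist D x ∘ proj₁) W ∷ ∑ proj₂ sources ∷ ∑ (λ B → radius B + radius B) sources ∷ List.length W · Δ ∷ [])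
        (λ { (L ∷ Δ ∷ F ∷ r ∷ ρ ∷ k ∷ []) →
          L ≼ ((Δ :- :0) :+ (Δ :- :0)) :+ ρ ∷ ρ :+ (r :+ r) ≼ k :+ k ∷ F ≼ r ∷ F ≼ r ∷ [] ⊢
          L :+ (F :+ F) ≼ (Δ :+ Δ) :+ (k :+ k) })
        (balls-cover center radius ((x , 0#) ∷ sources) (root∈ ∷ All.map source∈ started) cover)
        (≡.subst (λ n → ∑ (λ B → radius B + radius B) sources + (∑ proj₂ sources + ∑ proj₂ sources) ≤ n · Δ + n · Δ) #sources (∑-radii Δ sources)) late late
        where
        open Spreading circle (dist D x)
        F-lipschitz : Lipschitz circle (dist D x)
        F-lipschitz y z = ≤-trans (triangle D x y z) (+-monoʳ-≤ _ (glueAll≤ circle W y z))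

        open Spread (spread F-lipschitz (List.length W) W ≡.refl (glueAll-consistent circle W x)
          (dist circle x) (dist-Lipschitz circle x) (glueAll≤ circle W x))

        center radius : X × ℝ → ℝ
        center (c , _) = pos c
        radius (_ , r) = Δ - r

        -- The arrival times are Lipschitz on the circle and agree on every pair, hence they are
        -- Lipschitz for the glued metric; as they are at most 0 at `x`, they are bounded by the
        -- glued distance from `x`.
        arrival≤Δ : ∀ y → arrival y ≤ Δ
        arrival≤Δ y = linear
          (arrival y ∷ arrival x ∷ dist D x y ∷ dist circle x x ∷ Δ ∷ [])
          (λ { (y ∷ x ∷ xy ∷ xx ∷ Δ ∷ []) → y ≼ x :+ xy ∷ x ≼ xx ∷ xx ≼ :0 ∷ xy ≼ Δ ∷ [] ⊢ y ≼ Δ })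
          (Lipschitz-glueAll circle W lipschitz consistent x y) (arrival≤ x) (dist-refl circle x) (D≤Δ y)

        root∈ : Within L (pos x) × 0# ≤ Δ - 0#
        root∈ = pos∈ x , linear (dist D x x ∷ Δ ∷ [])
          (λ { (xx ∷ Δ ∷ []) → :0 ≼ xx ∷ xx ≼ Δ ∷ [] ⊢ :0 ≼ Δ :- :0 }) (dist-nonNeg D x x) (D≤Δ x)

        source∈ : ∀ {B : X × ℝ} → proj₂ B ≤ arrival (proj₁ B) → Within L (center B) × 0# ≤ radius B
        source∈ {c , r} r≤ = pos∈ c , linear (r ∷ arrival c ∷ Δ ∷ [])
          (λ { (r ∷ a ∷ Δ ∷ []) → r ≼ a ∷ a ≼ Δ ∷ [] ⊢ :0 ≼ Δ :- r }) r≤ (arrival≤Δ c)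

        reached : ∀ {t} → Within L t → ∀ c r → r + dist circle c (at t) ≤ arrival (at t) → arc (pos c) t ≤ Δ - r
        reached {t} t∈ c r p = linear
          (arc (pos c) t ∷ arc (pos c) (pos (at t)) ∷ arc (pos (at t)) t ∷ r ∷ arrival (at t) ∷ Δ ∷ [])
          (λ { (ct ∷ ct′ ∷ t′t ∷ r ∷ a ∷ Δ ∷ []) →
            ct ≼ ct′ :+ t′t ∷ t′t ≼ :0 ∷ r :+ ct′ ≼ a ∷ a ≼ Δ ∷ [] ⊢ ct ≼ Δ :- r })
          (arc-triangle (pos∈ c) (pos∈ (at t)) t∈) (pos-at t∈) p (arrival≤Δ (at t))

        cover : ∀ {t} → Within L t → Any (λ B → arc (center B) t ≤ radius B) ((x , 0#) ∷ sources)
        cover {t} t∈ with covered (at t)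
        ... | inj₁ p = here (reached t∈ x 0# (≤-respˡ-≈ (sym (+-identityˡ _)) p))
        ... | inj₂ i = there (Any.map (λ {B} → reached t∈ (proj₁ B) (proj₂ B)) i)

      ∑-dist : ∀ {x y Δ} → Δ ≤ dist D x y → ∀ (V : List (X × X)) →
               List.length V · Δ ≤ ∑ (dist D x ∘ proj₁) V + ∑ (dist D y ∘ proj₁) V
      ∑-dist                 Δ≤xy []            = ≤-reflexive (sym (+-identityˡ 0#))
      ∑-dist {x} {y} {Δ} Δ≤xy ((a , b) ∷ V) = linear
        (Δ ∷ dist D x y ∷ dist D x a ∷ dist D a y ∷ dist D y a ∷ List.length V · Δ ∷
          ∑ (dist D x ∘ proj₁) V ∷ ∑ (dist D y ∘ proj₁) V ∷ [])
        (λ { (Δ ∷ xy ∷ xa ∷ ay ∷ ya ∷ k ∷ X ∷ Y ∷ []) →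
          Δ ≼ xy ∷ xy ≼ xa :+ ay ∷ ay ≼ ya ∷ k ≼ X :+ Y ∷ [] ⊢ Δ :+ k ≼ (xa :+ X) :+ (ya :+ Y) })
        Δ≤xy (triangle D x a y) (dist-sym D a y) (∑-dist Δ≤xy V)

      length≤diameter : ∀ {Δ x y} → Δ ≤ dist D x y → (∀ u v → dist D u v ≤ Δ) →
                        L ≤ suc (suc (List.length W)) · Δ
      length≤diameter {Δ} {x} {y} Δ≤xy D≤Δ = double-cancel-≤ (linear
        (L ∷ Δ ∷ List.length W · Δ ∷ ∑ (dist D x ∘ proj₁) W ∷ ∑ (dist D y ∘ proj₁) W ∷ [])
        (λ { (L ∷ Δ ∷ k ∷ X ∷ Y ∷ []) →
          L :+ (X :+ X) ≼ (Δ :+ Δ) :+ (k :+ k) ∷ L :+ (Y :+ Y) ≼ (Δ :+ Δ) :+ (k :+ k) ∷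
          -- Used twice, because `growth` counts every distance to a wormhole twice.
          k ≼ X :+ Y ∷ k ≼ X :+ Y ∷ [] ⊢ L :+ L ≼ (Δ :+ (Δ :+ k)) :+ (Δ :+ (Δ :+ k)) })
        (growth x Δ (D≤Δ x)) (growth y Δ (D≤Δ y)) (∑-dist Δ≤xy W) (∑-dist Δ≤xy W))

-- The cycle graph with positions along the circle.

module Cycle (R : CompleteOrderedField) where
  open OrderedField R
  open Gluing R
  open Circle R
  open WormholeMetric R
  open MetricGraphs R

  prefix : ∀ {n} → (Fin n → ℝ) → ℕ → ℝ
  prefix         f zero    = 0#
  prefix {zero}  f (suc k) = 0#
  prefix {suc n} f (suc k) = f Fin.zero + prefix (f ∘ Fin.suc) k

  prefix-suc : ∀ {n} (f : Fin n → ℝ) i → prefix f (suc (toℕ i)) ≈ prefix f (toℕ i) + f i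
  prefix-suc f Fin.zero    = +-comm _ _
  prefix-suc f (Fin.suc i) = trans (+-congˡ (prefix-suc (f ∘ Fin.suc) i)) (sym (+-assoc _ _ _))

  prefix-all : ∀ {n} (f : Fin n → ℝ) → prefix f n ≈ sum f
  prefix-all {zero}  f = refl
  prefix-all {suc n} f = +-congˡ (prefix-all (f ∘ Fin.suc))

  prefix-mono : ∀ {n} {f : Fin n → ℝ} → (∀ i → 0# ≤ f i) → ∀ {j k} → j ℕ.≤ k → prefix f j ≤ prefix f k
  prefix-mono         0≤f {k = zero}  z≤n = ≤-refl
  prefix-mono {zero}  0≤f {k = suc k} z≤n = ≤-refl
  prefix-mono {suc n} 0≤f {k = suc k} z≤n = ≤-respˡ-≈ (+-identityˡ 0#)
    (+-mono-≤ (0≤f Fin.zero) (prefix-mono (0≤f ∘ Fin.suc) {zero} {k} z≤n))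
  prefix-mono {zero}  0≤f (s≤s j≤k)       = ≤-refl
  prefix-mono {suc n} 0≤f (s≤s j≤k)       = +-monoʳ-≤ _ (prefix-mono (0≤f ∘ Fin.suc) j≤k)

  -- A discrete intermediate value argument without monotonicity. It finds the edge of a position as
  -- well as the gap between equally spaced points.
  locate : ∀ (S : ℕ → ℝ) m {t} → S 0 ≤ t → t ≤ S (suc m) →
           ∃ λ k → k ℕ.< suc m × S k ≤ t × t ≤ S (suc k)
  locate S zero    S≤t t≤S = 0 , s≤s z≤n , S≤t , t≤S
  locate S (suc m) {t} S≤t t≤S with t ≤? S (suc m)
  ... | yes t≤ = let (k , k<m , p) = locate S m S≤t t≤ in k , ℕ.m≤n⇒m≤1+n k<m , p
  ... | no  t≰ = suc m , ℕ.≤-refl , ≰⇒≥ t≰ , t≤S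

  toℕ-mod : ∀ m n .{{_ : NonZero n}} → toℕ (m mod n) ≡ m % n
  toℕ-mod m n = toℕ-fromℕ< (m%n<n m n)

  toℕ-mod-< : ∀ {m n} .{{_ : NonZero n}} → m ℕ.< n → toℕ (m mod n) ≡ m
  toℕ-mod-< {m} {n} m<n = ≡.trans (toℕ-mod m n) (m<n⇒m%n≡m m<n)

  module CycleGraph {L : ℝ} (0≤L : 0# ≤ L) (n : ℕ) .{{_ : NonZero n}} (ℓ : Fin n → ℝ) (ℓ>0 : ∀ i → 0# < ℓ i)
           (sum≈L : sum ℓ ≈ L) where

    open Arc 0≤L

    G : MetricGraph
    G = cycle n ℓ ℓ>0

    0≤ℓ : ∀ i → 0# ≤ ℓ i
    0≤ℓ i = proj₁ (ℓ>0 i)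

    S : ℕ → ℝ
    S = prefix ℓ

    base : Fin n → ℝ
    base i = S (toℕ i)

    S-within : ∀ {k} → k ℕ.≤ n → Within L (S k)
    S-within {k} k≤n = prefix-mono 0≤ℓ {k = k} z≤n , ≤-respʳ-≈ (trans (prefix-all ℓ) sum≈L) (prefix-mono 0≤ℓ k≤n)

    edge-within : ∀ e {t} → Within (ℓ e) t → Within L (base e + t)
    edge-within e {t} (0≤t , t≤ℓ) =
      ≤-respˡ-≈ (+-identityˡ 0#) (+-mono-≤ (proj₁ (S-within {toℕ e} (ℕ.<⇒≤ (toℕ<n e)))) 0≤t) ,
      ≤-trans (≤-respʳ-≈ (sym (prefix-suc ℓ e)) (+-monoʳ-≤ _ t≤ℓ)) (proj₂ (S-within (toℕ<n e)))

    pos : Point G → ℝ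
    pos (vertex i)         = base i
    pos (interior e t _ _) = base e + t

    pos∈ : ∀ x → Within L (pos x)
    pos∈ (vertex i)                 = S-within (ℕ.<⇒≤ (toℕ<n i))
    pos∈ (interior e t (p , _) (q , _)) = edge-within e (p , q)

    open Wormholes 0≤L pos pos∈
    open PseudoMetric

    At-within : ∀ {x e t} → _At_,_ G x e t → Within (ℓ e) t
    At-within (atSource e)         = ≤-refl , 0≤ℓ e
    At-within (atTarget e)         = 0≤ℓ e , ≤-refl
    At-within (atInterior e t (p , _) (q , _)) = p , q

    arc-≈ : ∀ {s t} → s ≈ t → arc s t ≤ 0#
    arc-≈ {s} {t} s≈t = ≤-trans (x⊓y≤x _ _) (∣x-y∣≤
      (linear (s ∷ t ∷ []) (λ { (s ∷ t ∷ []) → s ≼ t ∷ [] ⊢ s :- t ≼ :0 }) (≤-reflexive s≈t))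
      (linear (s ∷ t ∷ []) (λ { (s ∷ t ∷ []) → t ≼ s ∷ [] ⊢ t :- s ≼ :0 }) (≤-reflexive (sym s≈t))))

    arc-0-L : arc 0# L ≤ 0#
    arc-0-L = ≤-trans (x⊓y≤y _ _) (linear (L ∷ ∣ 0# - L ∣ ∷ [])
      (λ { (L ∷ a ∷ []) → L :- :0 ≼ a ∷ [] ⊢ L :- a ≼ :0 }) (y-x≤∣x-y∣ 0# L))

    -- Equality up to arc length zero is the best possible: the last edge ends at position L, but
    -- its target is vertex 0.
    pos-At : ∀ {x e t} → _At_,_ G x e t → arc (pos x) (base e + t) ≤ 0#
    pos-At (atSource e)           = arc-≈ (sym (+-identityʳ _))
    pos-At (atInterior e t _ _)   = arc-refl (base e + t)
    pos-At (atTarget e) with ℕ.m≤n⇒m<n∨m≡n (toℕ<n e)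
    ... | inj₁ e+1<n rewrite toℕ-mod-< e+1<n = arc-≈ (prefix-suc ℓ e)
    ... | inj₂ e+1≡n = ≡.subst (λ k → arc (S k) (base e + ℓ e) ≤ 0#) (≡.sym wraps)
      (linear (arc 0# (base e + ℓ e) ∷ arc 0# L ∷ arc L (base e + ℓ e) ∷ [])
        (λ { (a ∷ b ∷ c ∷ []) → a ≼ b :+ c ∷ b ≼ :0 ∷ c ≼ :0 ∷ [] ⊢ a ≼ :0 })
        (arc-triangle (≤-refl , 0≤L) (0≤L , ≤-refl) (edge-within e (0≤ℓ e , ≤-refl)))
        arc-0-L (arc-≈ (trans (sym sum≈L) (trans (sym (prefix-all ℓ))
          (trans (reflexive (≡.cong S (≡.sym e+1≡n))) (prefix-suc ℓ e))))))
      where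
      wraps : toℕ (suc (toℕ e) mod n) ≡ 0
      wraps = ≡.trans (toℕ-mod (suc (toℕ e)) n) (≡.trans (≡.cong (_% n) e+1≡n) (n%n≡0 n))

    edge-dist : ∀ {x y e s t} → _At_,_ G x e s → _At_,_ G y e t → dist circle x y ≤ ∣ s - t ∣
    edge-dist {x} {y} {e} {s} {t} x∈e y∈e = linear
      (arc (pos x) (pos y) ∷ arc (pos x) p ∷ arc p (pos y) ∷ arc p q ∷ arc q (pos y) ∷ arc (pos y) q ∷ ∣ s - t ∣ ∷ [])
      (λ { (xy ∷ xp ∷ py ∷ pq ∷ qy ∷ yq ∷ st ∷ []) →
        xy ≼ xp :+ py ∷ py ≼ pq :+ qy ∷ xp ≼ :0 ∷ pq ≼ st ∷ qy ≼ yq ∷ yq ≼ :0 ∷ [] ⊢ xy ≼ st })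
      (arc-triangle (pos∈ x) p∈ (pos∈ y)) (arc-triangle p∈ q∈ (pos∈ y)) (pos-At x∈e)
      (≤-trans (x⊓y≤x _ _) (∣x-y∣≤
        (≤-respˡ-≈ (shift s t) (x-y≤∣x-y∣ s t)) (≤-respˡ-≈ (shift t s) (y-x≤∣x-y∣ s t))))
      (arc-sym q (pos y)) (pos-At y∈e)
      where
      p = base e + s
      q = base e + t
      p∈ = edge-within e (At-within x∈e)
      q∈ = edge-within e (At-within y∈e)
      shift : ∀ s t → s - t ≈ (base e + s) - (base e + t)
      shift s t = identity (base e ∷ s ∷ t ∷ []) λ { (b ∷ s ∷ t ∷ []) → s :- t ≍ (b :+ s) :- (b :+ t) }

    -- The two ends are split off because `interior` requires strict inequalities.
    on-edge : ∀ i {t} → base i ≤ t → t ≤ base i + ℓ i → ∃₂ λ x s → _At_,_ G x i s × base i + s ≈ t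
    on-edge i {t} base≤t t≤base+ℓ with t ≤? base i | base i + ℓ i ≤? t
    ... | yes t≤base | _      = vertex i , 0# , atSource i , trans (+-identityʳ _) (≤-antisym base≤t t≤base)
    ... | no _ | yes base+ℓ≤t = vertex _ , ℓ i , atTarget i , ≤-antisym base+ℓ≤t t≤base+ℓ
    ... | no t≰base | no ℓ≰t  = interior i (t - base i) s>0 s<ℓ , t - base i , atInterior i _ s>0 s<ℓ ,
        identity (t ∷ base i ∷ []) λ { (t ∷ b ∷ []) → b :+ (t :- b) ≍ t }
      where
      s>0 : 0# < t - base i
      s>0 = ≰⇒> λ p → t≰base (linear (t ∷ base i ∷ []) (λ { (t ∷ b ∷ []) → t :- b ≼ :0 ∷ [] ⊢ t ≼ b }) p)
      s<ℓ : t - base i < ℓ i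
      s<ℓ = ≰⇒> λ p → ℓ≰t (linear (t ∷ base i ∷ ℓ i ∷ [])
        (λ { (t ∷ b ∷ l ∷ []) → l ≼ t :- b ∷ [] ⊢ b :+ l ≼ t }) p)

    locate-edge : ∀ {t} → Within L t → ∃ λ i → base i ≤ t × t ≤ base i + ℓ i
    locate-edge {t} (0≤t , t≤L)
      with locate S (ℕ.pred n) 0≤t (≤-respʳ-≈ (sym (trans (reflexive (≡.cong S (ℕ.suc-pred n)))
                                                    (trans (prefix-all ℓ) sum≈L))) t≤L)
    ... | k , k<1+n-1 , S≤t , t≤S = i ,
      ≡.subst (λ j → S j ≤ t) (≡.sym i≡k) S≤t ,
      ≤-respʳ-≈ (prefix-suc ℓ i) (≡.subst (λ j → t ≤ S (suc j)) (≡.sym i≡k) t≤S)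
      where
      k<n : k ℕ.< n
      k<n = ≡.subst (k ℕ.<_) (ℕ.suc-pred n) k<1+n-1
      i : Fin n
      i = Fin.fromℕ< k<n
      i≡k : toℕ i ≡ k
      i≡k = toℕ-fromℕ< k<n

    point-within : ∀ {t} → Within L t → ∃ λ x → arc (pos x) t ≤ 0#
    point-within {t} t∈ =
      let (i , base≤t , t≤base+ℓ) = locate-edge t∈
          (x , s , x∈i , i+s≈t)   = on-edge i base≤t t≤base+ℓ
      in x , linear (arc (pos x) t ∷ arc (pos x) (base i + s) ∷ arc (base i + s) t ∷ [])
        (λ { (a ∷ b ∷ c ∷ []) → a ≼ b :+ c ∷ b ≼ :0 ∷ c ≼ :0 ∷ [] ⊢ a ≼ :0 })
        (arc-triangle (pos∈ x) (edge-within i (At-within x∈i)) t∈) (pos-At x∈i) (arc-≈ i+s≈t)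

    abstract
      point-at : ∀ t → ∃ λ x → Within L t → arc (pos x) t ≤ 0#
      point-at t with 0# ≤? t | t ≤? L
      -- Outside [0, L] a default vertex is returned and the claim is vacuous; `at` has to be total
      -- because `maximum` takes functions on all reals.
      ... | no 0≰t  | _       = vertex (0 mod n) , λ t∈ → ⊥-elim (0≰t (proj₁ t∈))
      ... | yes _   | no t≰L  = vertex (0 mod n) , λ t∈ → ⊥-elim (t≰L (proj₂ t∈))
      ... | yes 0≤t | yes t≤L = let (x , close) = point-within (0≤t , t≤L) in x , λ _ → close

    at : ℝ → Point G
    at t = proj₁ (point-at t)

    pos-at : ∀ {t} → Within L t → arc (pos (at t)) t ≤ 0#
    pos-at {t} = proj₂ (point-at t)

    -- Paths with wormholes realise the glued metric.

    module _ {w : ℕ} (W : Vec (Wormhole G) w) where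

      Reach : Point G → Point G → ℝ → Set
      Reach x y r = ∃ λ (p : Path W x y) → length W p ≤ r

      weaken : ∀ {x y r s} → r ≤ s → Reach x y r → Reach x y s
      weaken r≤s (p , p≤r) = p , ≤-trans p≤r r≤s

      reach-refl : ∀ {x} → Reach x x 0#
      reach-refl = [] , ≤-refl

      append : ∀ {x y z} → Path W x y → Path W y z → Path W x z
      append []                  q = q
      append (along e s t a b p) q = along e s t a b (append p q)
      append (cross c p)         q = cross c (append p q)

      length-append : ∀ {x y z} (p : Path W x y) (q : Path W y z) →
                      length W (append p q) ≈ length W p + length W q
      length-append []                  q = sym (+-identityˡ _)
      length-append (along e s t a b p) q = trans (+-congˡ (length-append p q)) (sym (+-assoc _ _ _))
      length-append (cross c p)         q = length-append p q

      infixr 5 _◅◅_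
      _◅◅_ : ∀ {x y z r s} → Reach x y r → Reach y z s → Reach x z (r + s)
      (p , p≤r) ◅◅ (q , q≤s) = append p q , ≤-respˡ-≈ (sym (length-append p q)) (+-mono-≤ p≤r q≤s)

      reach-along : ∀ {x y e s t} → _At_,_ G x e s → _At_,_ G y e t → Reach x y ∣ s - t ∣
      reach-along a b = along _ _ _ a b [] , ≤-reflexive (+-identityʳ _)

      reach-cross : ∀ {a b} → (a , b) ∈ W → Reach a b 0# × Reach b a 0#
      reach-cross i = (cross (inj₁ i) [] , ≤-refl) , (cross (inj₂ i) [] , ≤-refl)

      reverse : ∀ {x y} (p : Path W x y) → Reach y x (length W p)
      reverse []                  = reach-refl
      reverse (along e s t a b p) = weaken
        (≤-trans (≤-reflexive (+-comm _ _)) (+-mono-≤ (∣-∣-comm t s) ≤-refl)) (reverse p ◅◅ reach-along b a)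
      reverse (cross c p)         = weaken (≤-reflexive (+-identityʳ _)) (reverse p ◅◅ (cross (Sum.swap c) [] , ≤-refl))

      reach-sym : ∀ {x y r} → Reach x y r → Reach y x r
      reach-sym (p , p≤r) = weaken p≤r (reverse p)

      -- With natural numbers as indices, the target of an edge `e` is `V (suc (toℕ e))` by
      -- definition, also where the cycle closes.
      V : ℕ → Point G
      V k = vertex (k mod n)

      V-base : ∀ i → vertex i ≡ V (toℕ i)
      V-base i = ≡.cong vertex (toℕ-injective (≡.sym (toℕ-mod-< (toℕ<n i))))

      V-n : V n ≡ V 0
      V-n = ≡.cong vertex (toℕ-injective (≡.trans (toℕ-mod n n) (≡.trans (n%n≡0 n) (≡.sym (toℕ-mod-< (ℕ.>-nonZero⁻¹ n))))))

      reach-source : ∀ {x e s} → _At_,_ G x e s → Reach (V (toℕ e)) x s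
      reach-source {x} {e} {s} x∈e = ≡.subst (λ v → Reach v x s) (V-base e)
        (weaken (∣x-y∣≤
          (linear (s ∷ []) (λ { (s ∷ []) → :0 ≼ s ∷ :0 ≼ s ∷ [] ⊢ :0 :- s ≼ s }) 0≤s 0≤s)
          (linear (s ∷ []) λ { (s ∷ []) → [] ⊢ s :- :0 ≼ s }))
          (reach-along (atSource e) x∈e))
        where
        0≤s = proj₁ (At-within x∈e)

      reach-target : ∀ {x e s} → _At_,_ G x e s → Reach x (V (suc (toℕ e))) (ℓ e - s)
      reach-target {x} {e} {s} x∈e = weaken (∣x-y∣≤
        (linear (s ∷ ℓ e ∷ []) (λ { (s ∷ l ∷ []) → s ≼ l ∷ s ≼ l ∷ [] ⊢ s :- l ≼ l :- s }) s≤ℓ s≤ℓ) ≤-refl)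
        (reach-along x∈e (atTarget e))
        where
        s≤ℓ = proj₂ (At-within x∈e)

      reach-vertices : ∀ {i j} → i ℕ.≤′ j → j ℕ.≤ n → Reach (V i) (V j) (S j - S i)
      reach-vertices     ℕ.≤′-refl       _   = weaken (≤-reflexive (sym (-‿inverseʳ _))) reach-refl
      reach-vertices {i} (ℕ.≤′-step {j} i≤j) j<n = weaken
        (linear (S i ∷ S j ∷ ℓ e ∷ S (suc j) ∷ [])
          (λ { (i ∷ j ∷ l ∷ j+1 ∷ []) → j :+ l ≼ j+1 ∷ [] ⊢ (j :- i) :+ (l :- :0) ≼ j+1 :- i })
          (≡.subst (λ k → S k + ℓ e ≤ S (suc k)) e≡j (≤-reflexive (sym (prefix-suc ℓ e)))))
        (reach-vertices i≤j (ℕ.<⇒≤ j<n) ◅◅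
         ≡.subst (λ k → Reach (V j) (V (suc k)) (ℓ e - 0#)) e≡j (reach-target (atSource e)))
        where
        e = j mod n
        e≡j : toℕ e ≡ j
        e≡j = toℕ-mod-< j<n

      coordinates : ∀ x → ∃₂ λ e s → _At_,_ G x e s × base e + s ≈ pos x
      coordinates (vertex i)         = i , 0# , atSource i , +-identityʳ _
      coordinates (interior e t p q) = e , t , atInterior e t p q , refl

      -- The path runs forward from `x` to the end of its edge, on to `V n`, which is `V 0`, and
      -- forward again to `y`. It exists for any two points and is the short way when `x` lies far
      -- beyond `y`.
      reach-around : ∀ x y → Reach x y (L - (pos x - pos y))
      reach-around x y with coordinates x | coordinates y
      ... | e , s , x∈e , e+s≈x | f , t , y∈f , f+t≈y = weaken
        (linear (L ∷ S n ∷ S 0 ∷ pos x ∷ pos y ∷ base e ∷ s ∷ base f ∷ t ∷ ℓ e ∷ S (suc (toℕ e)) ∷ [])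
          (λ { (L ∷ Sn ∷ S0 ∷ x ∷ y ∷ e ∷ s ∷ f ∷ t ∷ l ∷ e+1 ∷ []) →
            e :+ l ≼ e+1 ∷ Sn ≼ L ∷ x ≼ e :+ s ∷ f :+ t ≼ y ∷ S0 ≼ S0 ∷ [] ⊢
            (l :- s) :+ ((Sn :- e+1) :+ ((f :- :0) :+ t)) ≼ L :- (x :- y) })
          (≤-reflexive (sym (prefix-suc ℓ e))) (≤-reflexive (trans (prefix-all ℓ) sum≈L))
          (≤-reflexive (sym e+s≈x)) (≤-reflexive f+t≈y) ≤-refl)
        (reach-target x∈e ◅◅ ≡.subst (λ v → Reach (V (suc (toℕ e))) v (S n - S (suc (toℕ e)))) V-n
           (reach-vertices (ℕ.≤⇒≤′ (toℕ<n e)) ℕ.≤-refl)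
          ◅◅ reach-vertices (ℕ.≤⇒≤′ z≤n) (ℕ.<⇒≤ (toℕ<n f)) ◅◅ reach-source y∈f)

      reach-forward : ∀ {x y e f s t} → _At_,_ G x e s → _At_,_ G y f t → toℕ e ℕ.< toℕ f →
                      Reach x y ((base f + t) - (base e + s))
      reach-forward {e = e} {f} {s} {t} x∈e y∈f e<f = weaken
        (linear (base e ∷ s ∷ base f ∷ t ∷ ℓ e ∷ S (suc (toℕ e)) ∷ [])
          (λ { (e ∷ s ∷ f ∷ t ∷ l ∷ e+1 ∷ []) → e :+ l ≼ e+1 ∷ [] ⊢
            (l :- s) :+ ((f :- e+1) :+ t) ≼ (f :+ t) :- (e :+ s) })
          (≤-reflexive (sym (prefix-suc ℓ e))))
        (reach-target x∈e ◅◅ reach-vertices (ℕ.≤⇒≤′ e<f) (ℕ.<⇒≤ (toℕ<n f)) ◅◅ reach-source y∈f)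

      reach-straight : ∀ x y → Reach x y ∣ pos x - pos y ∣
      reach-straight x y with coordinates x | coordinates y
      ... | e , s , x∈e , e+s≈x | f , t , y∈f , f+t≈y with ℕ.<-cmp (toℕ e) (toℕ f)
      ...   | tri< e<f _ _ = weaken (≤-trans (≤-reflexive (+-cong f+t≈y (-‿cong e+s≈x))) (y-x≤∣x-y∣ _ _)) (reach-forward x∈e y∈f e<f)
      ...   | tri> _ _ f<e = reach-sym (weaken (≤-trans (≤-reflexive (+-cong e+s≈x (-‿cong f+t≈y))) (x-y≤∣x-y∣ _ _)) (reach-forward y∈f x∈e f<e))
      ...   | tri≈ _ e≡f _ with toℕ-injective e≡f
      ...     | ≡.refl = weaken (∣x-y∣≤ (≤-trans (≤-reflexive (shift s t e+s≈x f+t≈y)) (x-y≤∣x-y∣ _ _))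
                                        (≤-trans (≤-reflexive (shift t s f+t≈y e+s≈x)) (y-x≤∣x-y∣ _ _)))
                                (reach-along x∈e y∈f)
        where
        shift : ∀ s t {p q} → base e + s ≈ p → base e + t ≈ q → s - t ≈ p - q
        shift s t p q = trans (identity (base e ∷ s ∷ t ∷ []) λ { (b ∷ s ∷ t ∷ []) → s :- t ≍ (b :+ s) :- (b :+ t) })
          (+-cong p (-‿cong q))

      reach-circle : ∀ x y → Reach x y (dist circle x y)
      reach-circle x y with ⊓-sel ∣ pos x - pos y ∣ (L - ∣ pos x - pos y ∣)
      ... | inj₁ eq = weaken (≤-reflexive (sym eq)) (reach-straight x y)
      ... | inj₂ eq with ⊔-sel (pos x - pos y) (pos y - pos x)
      ...   | inj₁ eq′ = weaken (≤-reflexive (sym (trans eq (+-congˡ (-‿cong eq′))))) (reach-around x y)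
      ...   | inj₂ eq′ = weaken (≤-reflexive (sym (trans eq (+-congˡ (-‿cong eq′))))) (reach-sym (reach-around y x))

      glued : PseudoMetric (Point G)
      glued = D at pos-at (toList W)

      glued≤length : ∀ {x y} (p : Path W x y) → dist glued x y ≤ length W p
      glued≤length {x} []                              = dist-refl glued x
      glued≤length {x} {z} (along {y = y} e s t a b p) = ≤-trans (triangle glued x y z)
        (+-mono-≤ (≤-trans (glueAll≤ circle (toList W) x y) (edge-dist a b)) (glued≤length p))
      glued≤length {x} {z} (cross {y = y} c p)         = ≤-trans (triangle glued x y z)
        (≤-respʳ-≈ (+-identityˡ _) (+-mono-≤ (crossing c) (glued≤length p)))
        where
        crossing : (x , y) ∈ W ⊎ (y , x) ∈ W → dist glued x y ≤ 0#
        crossing (inj₁ i) = glueAll-∈ circle (∈-toList⁺ i)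
        crossing (inj₂ i) = ≤-trans (dist-sym glued x y) (glueAll-∈ circle (∈-toList⁺ i))

      -- No path is shorter than the glued distance, by `glued≤length`, and some path is no longer,
      -- by `glueAll-reach`. The value `r` is only squeezed from both sides, so that L/(w + 2) can
      -- take the place of the glued distance.
      isDistance : ∀ {x y r} → dist glued x y ≤ r → r ≤ dist glued x y → IsDistance W x y r
      isDistance {x} {y} d≤r r≤d = (p , ≤-antisym (≤-trans p≤d d≤r) (r≤length p)) , r≤length
        where
        r≤length : ∀ (p : Path W x y) → _ ≤ length W p
        r≤length p = ≤-trans r≤d (glued≤length p)
        shortest : Reach x y (dist glued x y)
        shortest = glueAll-reach Reach weaken _◅◅_ circle reach-circle (toList W)
          (reach-cross ∘ ∈-toList⁻) x y
        p   = proj₁ shortest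
        p≤d = proj₂ shortest

      isDiameter : ∀ {x y r} → dist glued x y ≤ r → r ≤ dist glued x y →
                   (∀ u v → dist glued u v ≤ r) → IsDiameter W r
      isDiameter d≤r r≤d all≤r = (_ , _ , isDistance d≤r r≤d) ,
        λ u v → dist glued u v , isDistance ≤-refl ≤-refl , all≤r u v

    length≤ : ∀ {w} (W : Vec (Wormhole G) w) {x y r} → r ≤ dist (glued W) x y →
              (∀ u v → dist (glued W) u v ≤ r) → L ≤ suc (suc w) · r
    length≤ W {r = r} r≤ maximal = ≡.subst (λ k → L ≤ suc (suc k) · r) (length-toList W)
      (length≤diameter at pos-at (toList W) r≤ maximal)

    diameter≥ : ∀ w {δ} → suc (suc w) · δ ≈ L → (W : Vec (Wormhole G) w) →
                ∃ λ r → IsDiameter W r × δ ≤ r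
    diameter≥ w δ-spec W =
      let (x , y , maximal) = diameter at pos-at (toList W) in
      dist (glued W) x y , isDiameter W ≤-refl ≤-refl maximal ,
      ·-cancelˡ-≤ (suc w) (≤-trans (≤-reflexive δ-spec) (length≤ W ≤-refl maximal))

    -- The extremal configuration for even `w`.

    module Alternating (w : ℕ) (even : 2 ∣ w) {δ : ℝ} (0≤δ : 0# ≤ δ) (δ-spec : suc (suc w) · δ ≈ L) where

      P : ℕ → Point G
      P j = at (j · δ)

      P∈ : ∀ {j} → j ℕ.≤ suc (suc w) → Within L (j · δ)
      P∈ {j} j≤ = ·-nonNeg j 0≤δ , ≤-respʳ-≈ δ-spec (·-monoˡ-≤ 0≤δ j≤)

      -- The points P 0 to P (w + 1) form two chains, of even and of odd indices, so `w` wormholes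
      -- join them all. The last one ends at P (w + 1), because P (w + 2) closes up with P 0.
      W : Vec (Wormhole G) w
      W = Vec.tabulate λ i → P (toℕ i) , P (suc (suc (toℕ i)))

      hop : ∀ {j} → j ℕ.< w → dist (glued W) (P j) (P (suc (suc j))) ≤ 0#
      hop j<w = glueAll-∈ circle (∈-toList⁺ (≡.subst (λ j → (P j , P (suc (suc j))) ∈ W)
        (toℕ-fromℕ< j<w) (∈-tabulate⁺ _ (Fin.fromℕ< j<w))))

      -- The representative of each chain: P 0 and P 1 are the points A and B, and the recursion by
      -- two steps keeps track of parity.
      anchor : ℕ → Point G
      anchor zero          = P 0
      anchor (suc zero)    = P 1
      anchor (suc (suc j)) = anchor j

      d : Point G → Point G → ℝ
      d = dist (glued W)

      to-anchor : ∀ {j} → j ℕ.≤ suc w → d (P j) (anchor j) ≤ 0#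
      to-anchor {zero}        _               = dist-refl (glued W) _
      to-anchor {suc zero}    _               = dist-refl (glued W) _
      to-anchor {suc (suc j)} (s≤s j<w) = linear
        (d (P (suc (suc j))) (anchor j) ∷ d (P (suc (suc j))) (P j) ∷ d (P j) (P (suc (suc j))) ∷ d (P j) (anchor j) ∷ [])
        (λ { (ac ∷ ab ∷ ba ∷ bc ∷ []) → ac ≼ ab :+ bc ∷ ab ≼ ba ∷ ba ≼ :0 ∷ bc ≼ :0 ∷ [] ⊢ ac ≼ :0 })
        (triangle (glued W) _ _ _) (dist-sym (glued W) _ _) (hop j<w)
        (to-anchor (ℕ.m≤n⇒m≤1+n (ℕ.<⇒≤ j<w)))

      anchor-even : ∀ {k} → 2 ∣ k → anchor k ≡ P 0
      anchor-even (divides zero    ≡.refl) = ≡.refl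
      anchor-even (divides (suc q) ≡.refl) = anchor-even (divides q ≡.refl)

      -- P (w + 2) lies at L, that is at 0; as w is even, its anchor is indeed P 0.
      to-anchor-last : d (P (suc (suc w))) (anchor (suc (suc w))) ≤ 0#
      to-anchor-last = ≡.subst (λ v → d (P (suc (suc w))) v ≤ 0#) (≡.sym (anchor-even even))
        (≤-trans (glueAll≤ circle (toList W) _ _) (linear
          (arc p q ∷ arc p last ∷ arc last q ∷ arc last L ∷ arc L q ∷ arc L 0# ∷ arc 0# L ∷ arc 0# q ∷ arc q 0# ∷ [])
          (λ { (pq ∷ pl ∷ lq ∷ lL ∷ Lq ∷ L0 ∷ 0L ∷ 0q ∷ q0 ∷ []) →
            pq ≼ pl :+ lq ∷ lq ≼ lL :+ Lq ∷ Lq ≼ L0 :+ 0q ∷ pl ≼ :0 ∷ lL ≼ :0 ∷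
            L0 ≼ 0L ∷ 0L ≼ :0 ∷ 0q ≼ q0 ∷ q0 ≼ :0 ∷ [] ⊢ pq ≼ :0 })
          (arc-triangle (pos∈ (P (suc (suc w)))) last∈ (pos∈ (P 0))) (arc-triangle last∈ L∈ (pos∈ (P 0)))
          (arc-triangle L∈ 0∈ (pos∈ (P 0)))
          (pos-at last∈) (arc-≈ δ-spec) (arc-sym L 0#) arc-0-L (arc-sym 0# q) (pos-at 0∈)))
        where
        last = suc (suc w) · δ
        p    = pos (P (suc (suc w)))
        q    = pos (P 0)
        last∈ : Within L last
        last∈ = P∈ ℕ.≤-refl
        0∈ : Within L 0#
        0∈ = ≤-refl , 0≤L
        L∈ : Within L L
        L∈ = 0≤L , ≤-refl

      near-anchor : ∀ {j} → j ℕ.≤ suc (suc w) → d (P j) (anchor j) ≤ 0#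
      near-anchor j≤w+2 with ℕ.m≤n⇒m<n∨m≡n j≤w+2
      ... | inj₁ (s≤s j≤w+1) = to-anchor j≤w+1
      ... | inj₂ ≡.refl      = to-anchor-last

      anchors : ∀ k → (anchor k ≡ P 0 × anchor (suc k) ≡ P 1) ⊎ (anchor k ≡ P 1 × anchor (suc k) ≡ P 0)
      anchors zero          = inj₁ (≡.refl , ≡.refl)
      anchors (suc zero)    = inj₂ (≡.refl , ≡.refl)
      anchors (suc (suc k)) = anchors k

      d-anchor : ∀ x {j r} → j ℕ.≤ suc (suc w) → ∣ pos x - j · δ ∣ ≤ r → d x (anchor j) ≤ r
      d-anchor x {j} {r} j≤ p = linear
        (d x (anchor j) ∷ d x x′ ∷ d x′ (anchor j) ∷ d x′ (P j) ∷ d (P j) (anchor j) ∷ ∣ pos x - j · δ ∣ ∷ r ∷ [])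
        (λ { (xa ∷ xx′ ∷ x′a ∷ x′p ∷ pa ∷ abs ∷ r ∷ []) →
          xa ≼ xx′ :+ x′a ∷ x′a ≼ x′p :+ pa ∷ xx′ ≼ :0 ∷ x′p ≼ abs ∷ abs ≼ r ∷ pa ≼ :0 ∷ [] ⊢ xa ≼ r })
        (triangle (glued W) _ _ _) (triangle (glued W) _ _ _) (D-at-pos at pos-at (toList W) x)
        (D-at at pos-at (toList W) (pos∈ x) (P∈ j≤)) p (near-anchor j≤)
        where
        x′ = at (pos x)

      -- A point lies in a gap of length δ between P k and P (k + 1), and its distances to the two
      -- ends add up to at most δ. One end belongs to each chain; in the last gap this is where the
      -- parity of `w` enters.
      both-anchors : ∀ x → d x (P 0) + d x (P 1) ≤ δ
      both-anchors x with locate (_· δ) (suc w) (proj₁ (pos∈ x)) (≤-respʳ-≈ (sym δ-spec) (proj₂ (pos∈ x)))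
      ... | k , k<w+2 , kδ≤x , x≤kδ+δ = conclude (anchors k)
        where
        sum≤δ : d x (anchor k) + d x (anchor (suc k)) ≤ δ
        sum≤δ = linear
          (d x (anchor k) ∷ d x (anchor (suc k)) ∷ pos x ∷ k · δ ∷ δ ∷ [])
          (λ { (a ∷ b ∷ x ∷ kδ ∷ δ ∷ []) → a ≼ x :- kδ ∷ b ≼ (δ :+ kδ) :- x ∷ [] ⊢ a :+ b ≼ δ })
          (d-anchor x (ℕ.<⇒≤ k<w+2) (∣x-y∣≤ ≤-refl
            (linear (pos x ∷ k · δ ∷ []) (λ { (x ∷ kδ ∷ []) → kδ ≼ x ∷ kδ ≼ x ∷ [] ⊢ kδ :- x ≼ x :- kδ }) kδ≤x kδ≤x)))
          (d-anchor x k<w+2 (∣x-y∣≤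
            (linear (pos x ∷ k · δ ∷ δ ∷ []) (λ { (x ∷ kδ ∷ δ ∷ []) →
              x ≼ δ :+ kδ ∷ x ≼ δ :+ kδ ∷ [] ⊢ x :- (δ :+ kδ) ≼ (δ :+ kδ) :- x }) x≤kδ+δ x≤kδ+δ)
            ≤-refl))

        conclude : (anchor k ≡ P 0 × anchor (suc k) ≡ P 1) ⊎ (anchor k ≡ P 1 × anchor (suc k) ≡ P 0) →
                   d x (P 0) + d x (P 1) ≤ δ
        conclude (inj₁ (p , q)) = ≡.subst₂ (λ a b → d x a + d x b ≤ δ) p q sum≤δ
        conclude (inj₂ (p , q)) = ≤-trans (≤-reflexive (+-comm _ _)) (≡.subst₂ (λ a b → d x a + d x b ≤ δ) p q sum≤δ)

      -- The average of the triangle inequalities through P 0 and through P 1.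
      diameter≤ : ∀ x y → d x y ≤ δ
      diameter≤ x y = double-cancel-≤ (linear
        (d x y ∷ d x (P 0) ∷ d (P 0) y ∷ d y (P 0) ∷ d x (P 1) ∷ d (P 1) y ∷ d y (P 1) ∷ δ ∷ [])
        (λ { (xy ∷ xa ∷ ay ∷ ya ∷ xb ∷ by ∷ yb ∷ δ ∷ []) →
          xy ≼ xa :+ ay ∷ xy ≼ xb :+ by ∷ ay ≼ ya ∷ by ≼ yb ∷ xa :+ xb ≼ δ ∷ ya :+ yb ≼ δ ∷ [] ⊢
          xy :+ xy ≼ δ :+ δ })
        (triangle (glued W) _ _ _) (triangle (glued W) _ _ _) (dist-sym (glued W) _ _) (dist-sym (glued W) _ _)
        (both-anchors x) (both-anchors y))

      -- The lower bound valid for all choices of wormholes shows that the farthest pair is at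
      -- distance at least δ.
      attained : IsDiameter W δ
      attained =
        let (x , y , maximal) = diameter at pos-at (toList W) in
        isDiameter W (diameter≤ x y)
          (·-cancelˡ-≤ (suc w) (≤-trans (≤-reflexive δ-spec) (length≤ W ≤-refl maximal)))
          diameter≤

mainTheorem7 :
    (R : CompleteOrderedField) →
    let open CompleteOrderedField R renaming (Carrier to ℝ)
        open MetricGraphs R in
    (L : ℝ) → 0# < L →
    (n : ℕ) .{{_ : NonZero n}} (ℓ : Fin n → ℝ) (ℓ>0 : ∀ i → 0# < ℓ i) →
    let G = cycle n ℓ ℓ>0 in
    totalLength G ≈ L →
    (w : ℕ) →
    ((W : Vec (Wormhole G) w) → ∃ λ D → IsDiameter W D × (L ÷ (w +ℕ 2) ≤ D))
    × (2 ∣ w → ∃ λ (W : Vec (Wormhole G) w) → IsDiameter W (L ÷ (w +ℕ 2)))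
mainTheorem7 R L (0≤L , _) n ℓ ℓ>0 sum≈L w =
  diameter≥ w δ-spec , λ even → let open Alternating w even 0≤δ δ-spec in W , attained
  where
  open OrderedField R
  open Cycle R
  open CycleGraph 0≤L n ℓ ℓ>0 sum≈L

  δ : ℝ
  δ = L ÷ (w +ℕ 2)

  δ-spec : suc (suc w) · δ ≈ L
  δ-spec rewrite ℕ.+-comm w 2 = ·-÷ (suc w) L

  0≤δ : 0# ≤ δ
  0≤δ = ·-cancelˡ-≤ (suc w) (≤-trans (·-zeroʳ-≤ (suc (suc w))) (≤-respʳ-≈ (sym δ-spec) 0≤L))
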